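{- For all real $y\ge2$ and all $n\ge1$, $|P_n(y)|\le 3\cdot n!\,y^n$; moreover $|P_0(y)|\le y$ for $y\ge2$.
   Context: The polynomials $P_n(y)$ are defined by $P_0(y)=y-1$ and, for $n\ge1$, $P_n=nP_{n-1}-P'_{n-1}+\frac{1}{n}\sum_{k=1}^{n-1}k\{(k-1)P_{k-1}-P_k-P'_{k-1}\}P_{n-k-1}$, primes denoting derivatives in $y$ (equivalently, $1+\sum_{n\ge1}P_{n-1}(y)x^{ -n}$ is the unique formal solution of $V=1+\frac{y}{x}-\frac{1}{x}V-V_x-\frac{1}{x}V_y+\frac{1}{x}\log V$). -}

module Defs where

open import Data.Nat.Base as ℕ using (ℕ; zero; suc; _∸_)
import Data.Nat.Properties as ℕₚ
open import Data.Integer.Base using (+_)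
open import Data.Rational.Base
open import Data.Rational.Properties
open import Data.Rational.Solver using (module +-*-Solver)
open import Data.List.Base using (List; []; _∷_; map)
open import Data.Product.Base using (∃; _,_; proj₁; proj₂)
open import Data.Sum.Base using (inj₁; inj₂)
open import Relation.Nullary.Decidable using (yes; no)
open import Relation.Nullary.Negation using (contradiction)
open import Relation.Binary.PropositionalEquality

open +-*-Solver using (solve; _:=_; _:+_; _:*_; _:-_; :-_)

ℕ→ℚ : ℕ → ℚ
ℕ→ℚ n = + n / 1

-- Real numbers: Cauchy sequences of rationals.  Two sequences x, y denote
-- the same real exactly when x ≤ᴿ y and y ≤ᴿ x.

IsCauchy : (ℕ → ℚ) → Set
IsCauchy s = ∀ ε → 0ℚ < ε →
  ∃ λ N → ∀ m n → N ℕ.≤ m → N ℕ.≤ n → ∣ s m - s n ∣ < ε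

record ℝ : Set where
  constructor mkℝ
  field
    seq    : ℕ → ℚ
    cauchy : IsCauchy seq

open ℝ public

infix 4 _≤ᴿ_

_≤ᴿ_ : ℝ → ℝ → Set
x ≤ᴿ y = ∀ ε → 0ℚ < ε → ∃ λ N → ∀ n → N ℕ.≤ n → seq x n ≤ seq y n + ε

ℚ→ℝ : ℚ → ℝ
ℚ→ℝ q = mkℝ (λ _ → q) λ ε 0<ε → 0 , λ _ _ _ _ →
  subst (_< ε) (sym (cong ∣_∣ (+-inverseʳ q))) 0<ε

ℕ→ℝ : ℕ → ℝ
ℕ→ℝ n = ℚ→ℝ (ℕ→ℚ n)

private
  half-pos : ∀ {ε} → 0ℚ < ε → 0ℚ < ½ * ε
  half-pos {ε} 0<ε = subst (_< ½ * ε) (*-zeroʳ ½) (*-monoʳ-<-pos ½ 0<ε)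

  halves : ∀ ε → ½ * ε + ½ * ε ≡ ε
  halves ε = trans (sym (*-distribʳ-+ ε ½ ½)) (*-identityˡ ε)

  ∣-∣-reverse-half : ∀ p q → ∣ p ∣ - ∣ q ∣ ≤ ∣ p - q ∣
  ∣-∣-reverse-half p q = begin
    ∣ p ∣ - ∣ q ∣               ≡⟨ cong (λ t → ∣ t ∣ - ∣ q ∣) (split p q) ⟩
    ∣ (p - q) + q ∣ - ∣ q ∣     ≤⟨ +-monoˡ-≤ (- ∣ q ∣) (∣p+q∣≤∣p∣+∣q∣ (p - q) q) ⟩
    ∣ p - q ∣ + ∣ q ∣ - ∣ q ∣   ≡⟨ cancel ∣ p - q ∣ ∣ q ∣ ⟩
    ∣ p - q ∣                   ∎
    where
    open ≤-Reasoning
    split : ∀ p q → p ≡ (p - q) + q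
    split = solve 2 (λ p q → p := (p :- q) :+ q) refl
    cancel : ∀ a b → a + b - b ≡ a
    cancel = solve 2 (λ a b → a :+ b :- b := a) refl

  flip-- : ∀ p q → - (p - q) ≡ q - p
  flip-- = solve 2 (λ p q → :- (p :- q) := q :- p) refl

  ∣-∣-comm : ∀ p q → ∣ p - q ∣ ≡ ∣ q - p ∣
  ∣-∣-comm p q = trans (sym (∣-p∣≡∣p∣ (p - q))) (cong ∣_∣ (flip-- p q))

  ∣-∣-reverse : ∀ p q → ∣ ∣ p ∣ - ∣ q ∣ ∣ ≤ ∣ p - q ∣
  ∣-∣-reverse p q with ∣p∣≡p∨∣p∣≡-p (∣ p ∣ - ∣ q ∣)
  ... | inj₁ e = subst (_≤ ∣ p - q ∣) (sym e) (∣-∣-reverse-half p q)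
  ... | inj₂ e = subst₂ _≤_ (sym (trans e (flip-- ∣ p ∣ ∣ q ∣))) (∣-∣-comm q p)
                   (∣-∣-reverse-half q p)

  ⊔-≤ˡ : ∀ {m n k} → m ℕ.⊔ n ℕ.≤ k → m ℕ.≤ k
  ⊔-≤ˡ {m} {n} = ℕₚ.m⊔n≤o⇒m≤o m n

  ⊔-≤ʳ : ∀ {m n k} → m ℕ.⊔ n ℕ.≤ k → n ℕ.≤ k
  ⊔-≤ʳ {m} {n} = ℕₚ.m⊔n≤o⇒n≤o m n

  +-cauchy : ∀ s t → IsCauchy s → IsCauchy t → IsCauchy (λ n → s n + t n)
  +-cauchy s t cs ct ε 0<ε
    with cs (½ * ε) (half-pos 0<ε) | ct (½ * ε) (half-pos 0<ε)
  ... | M , hM | N , hN = M ℕ.⊔ N , λ m n p q → begin-strict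
    ∣ s m + t m - (s n + t n) ∣     ≡⟨ cong ∣_∣ (regroup (s m) (t m) (s n) (t n)) ⟩
    ∣ (s m - s n) + (t m - t n) ∣   ≤⟨ ∣p+q∣≤∣p∣+∣q∣ (s m - s n) (t m - t n) ⟩
    ∣ s m - s n ∣ + ∣ t m - t n ∣   <⟨ +-mono-< (hM m n (⊔-≤ˡ p) (⊔-≤ˡ q)) (hN m n (⊔-≤ʳ p) (⊔-≤ʳ q)) ⟩
    ½ * ε + ½ * ε                   ≡⟨ halves ε ⟩
    ε                               ∎
    where
    open ≤-Reasoning
    regroup : ∀ a b c d → a + b - (c + d) ≡ (a - c) + (b - d)
    regroup = solve 4 (λ a b c d → a :+ b :- (c :+ d) := (a :- c) :+ (b :- d)) refl

  eventually-bounded : ∀ s → IsCauchy s →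
    ∃ λ B → ∃ λ N → ∀ n → N ℕ.≤ n → ∣ s n ∣ ≤ B
  eventually-bounded s cs with cs 1ℚ (positive⁻¹ 1ℚ)
  ... | N , h = ∣ s N ∣ + 1ℚ , N , λ n p → begin
    ∣ s n ∣                    ≡⟨ cong ∣_∣ (split (s n) (s N)) ⟩
    ∣ s N + (s n - s N) ∣      ≤⟨ ∣p+q∣≤∣p∣+∣q∣ (s N) (s n - s N) ⟩
    ∣ s N ∣ + ∣ s n - s N ∣    ≤⟨ +-monoʳ-≤ ∣ s N ∣ (<⇒≤ (h n N p ℕₚ.≤-refl)) ⟩
    ∣ s N ∣ + 1ℚ               ∎
    where
    open ≤-Reasoning
    split : ∀ a b → a ≡ b + (a - b)
    split = solve 2 (λ a b → a := b :+ (a :- b)) refl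

  module _ (s t : ℕ → ℚ) (cs : IsCauchy s) (ct : IsCauchy t) where

    private
      A B C : ℚ
      A = proj₁ (eventually-bounded s cs)
      B = proj₁ (eventually-bounded t ct)
      C = 1ℚ + (∣ A ∣ + ∣ B ∣)

      0<C : 0ℚ < C
      0<C = <-≤-trans (positive⁻¹ 1ℚ)
        (subst (_≤ C) (+-identityʳ 1ℚ)
          (+-monoʳ-≤ 1ℚ (+-mono-≤ (0≤∣p∣ A) (0≤∣p∣ B))))

      instance
        C-pos : Positive C
        C-pos = positive 0<C

        C≢0 : NonZero C
        C≢0 = pos⇒nonZero C

        C-nonNeg : NonNegative C
        C-nonNeg = pos⇒nonNeg C

        1/C-pos : Positive (1/ C)
        1/C-pos = 1/pos⇒pos C

      p≤∣p∣ : ∀ p → p ≤ ∣ p ∣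
      p≤∣p∣ p with ≤-total 0ℚ p
      ... | inj₁ 0≤p = ≤-reflexive (sym (0≤p⇒∣p∣≡p 0≤p))
      ... | inj₂ p≤0 = ≤-trans p≤0 (0≤∣p∣ p)

      A≤C : A ≤ C
      A≤C = begin
        A                         ≤⟨ p≤∣p∣ A ⟩
        ∣ A ∣                     ≡⟨ pad ∣ A ∣ ⟩
        0ℚ + (∣ A ∣ + 0ℚ)         ≤⟨ +-mono-≤ (<⇒≤ (positive⁻¹ 1ℚ)) (+-monoʳ-≤ ∣ A ∣ (0≤∣p∣ B)) ⟩
        C                         ∎
        where
        open ≤-Reasoning
        pad : ∀ a → a ≡ 0ℚ + (a + 0ℚ)
        pad a = sym (trans (+-identityˡ _) (+-identityʳ a))

      B≤C : B ≤ C
      B≤C = begin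
        B                         ≤⟨ p≤∣p∣ B ⟩
        ∣ B ∣                     ≡⟨ pad ∣ B ∣ ⟩
        0ℚ + (0ℚ + ∣ B ∣)         ≤⟨ +-mono-≤ (<⇒≤ (positive⁻¹ 1ℚ)) (+-monoˡ-≤ ∣ B ∣ (0≤∣p∣ A)) ⟩
        C                         ∎
        where
        open ≤-Reasoning
        pad : ∀ b → b ≡ 0ℚ + (0ℚ + b)
        pad b = sym (trans (+-identityˡ _) (+-identityˡ b))

      scaled : ∀ p q {δ} → ∣ p ∣ ≤ C → ∣ q ∣ < δ → ∣ p * q ∣ < C * δ
      scaled p q {δ} p≤C q<δ = begin-strict
        ∣ p * q ∣       ≡⟨ ∣p*q∣≡∣p∣*∣q∣ p q ⟩
        ∣ p ∣ * ∣ q ∣   ≤⟨ *-monoʳ-≤-nonNeg ∣ q ∣ {{∣-∣-nonNeg q}} p≤C ⟩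
        C * ∣ q ∣       <⟨ *-monoʳ-<-pos C q<δ ⟩
        C * δ           ∎
        where open ≤-Reasoning

    *-cauchy : IsCauchy (λ n → s n * t n)
    *-cauchy ε 0<ε = N , λ m n p q → begin-strict
      ∣ s m * t m - s n * t n ∣
        ≡⟨ cong ∣_∣ (regroup (s m) (t m) (s n) (t n)) ⟩
      ∣ s m * (t m - t n) + t n * (s m - s n) ∣
        ≤⟨ ∣p+q∣≤∣p∣+∣q∣ (s m * (t m - t n)) (t n * (s m - s n)) ⟩
      ∣ s m * (t m - t n) ∣ + ∣ t n * (s m - s n) ∣
        <⟨ +-mono-<
             (scaled (s m) (t m - t n)
               (≤-trans (proj₂ (proj₂ (eventually-bounded s cs)) m (N₁≤ p)) A≤C)
               (proj₂ (ct δ 0<δ) m n (N₄≤ p) (N₄≤ q)))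
             (scaled (t n) (s m - s n)
               (≤-trans (proj₂ (proj₂ (eventually-bounded t ct)) n (N₂≤ q)) B≤C)
               (proj₂ (cs δ 0<δ) m n (N₃≤ p) (N₃≤ q))) ⟩
      C * δ + C * δ
        ≡⟨ cong₂ _+_ Cδ Cδ ⟩
      ½ * ε + ½ * ε
        ≡⟨ halves ε ⟩
      ε ∎
      where
      open ≤-Reasoning
      δ : ℚ
      δ = 1/ C * (½ * ε)
      0<δ : 0ℚ < δ
      0<δ = subst (_< δ) (*-zeroʳ (1/ C)) (*-monoʳ-<-pos (1/ C) (half-pos 0<ε))
      Cδ : C * δ ≡ ½ * ε
      Cδ = trans (sym (*-assoc C (1/ C) (½ * ε)))
             (trans (cong (_* (½ * ε)) (*-inverseʳ C)) (*-identityˡ (½ * ε)))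
      N₁ N₂ N₃ N₄ N : ℕ
      N₁ = proj₁ (proj₂ (eventually-bounded s cs))
      N₂ = proj₁ (proj₂ (eventually-bounded t ct))
      N₃ = proj₁ (cs δ 0<δ)
      N₄ = proj₁ (ct δ 0<δ)
      N = (N₁ ℕ.⊔ N₂) ℕ.⊔ (N₃ ℕ.⊔ N₄)
      N₁≤ : ∀ {k} → N ℕ.≤ k → N₁ ℕ.≤ k
      N₁≤ p = ⊔-≤ˡ {N₁} {N₂} (⊔-≤ˡ {N₁ ℕ.⊔ N₂} {N₃ ℕ.⊔ N₄} p)
      N₂≤ : ∀ {k} → N ℕ.≤ k → N₂ ℕ.≤ k
      N₂≤ p = ⊔-≤ʳ {N₁} {N₂} (⊔-≤ˡ {N₁ ℕ.⊔ N₂} {N₃ ℕ.⊔ N₄} p)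
      N₃≤ : ∀ {k} → N ℕ.≤ k → N₃ ℕ.≤ k
      N₃≤ p = ⊔-≤ˡ {N₃} {N₄} (⊔-≤ʳ {N₁ ℕ.⊔ N₂} {N₃ ℕ.⊔ N₄} p)
      N₄≤ : ∀ {k} → N ℕ.≤ k → N₄ ℕ.≤ k
      N₄≤ p = ⊔-≤ʳ {N₃} {N₄} (⊔-≤ʳ {N₁ ℕ.⊔ N₂} {N₃ ℕ.⊔ N₄} p)
      regroup : ∀ a b c d → a * b - c * d ≡ a * (b - d) + d * (a - c)
      regroup = solve 4 (λ a b c d → a :* b :- c :* d := a :* (b :- d) :+ d :* (a :- c)) refl

infixl 6 _+ᴿ_
infixl 7 _*ᴿ_
infixr 8 _^ᴿ_

_+ᴿ_ : ℝ → ℝ → ℝ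
x +ᴿ y = mkℝ (λ n → seq x n + seq y n) (+-cauchy (seq x) (seq y) (cauchy x) (cauchy y))

_*ᴿ_ : ℝ → ℝ → ℝ
x *ᴿ y = mkℝ (λ n → seq x n * seq y n) (*-cauchy (seq x) (seq y) (cauchy x) (cauchy y))

∣_∣ᴿ : ℝ → ℝ
∣ x ∣ᴿ = mkℝ (λ n → ∣ seq x n ∣) λ ε 0<ε → proj₁ (cauchy x ε 0<ε) , λ m n p q →
  ≤-<-trans (∣-∣-reverse (seq x m) (seq x n)) (proj₂ (cauchy x ε 0<ε) m n p q)

_^ᴿ_ : ℝ → ℕ → ℝ
x ^ᴿ zero  = ℕ→ℝ 1
x ^ᴿ suc n = x *ᴿ x ^ᴿ n

-- Polynomials in y over ℚ: a₀ ∷ a₁ ∷ … stands for a₀ + a₁ y + …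

Poly : Set
Poly = List ℚ

infixl 6 _+ₚ_ _-ₚ_
infixl 7 _*ₚ_ _·ₚ_

_+ₚ_ : Poly → Poly → Poly
[]      +ₚ q       = q
(a ∷ p) +ₚ []      = a ∷ p
(a ∷ p) +ₚ (b ∷ q) = (a + b) ∷ (p +ₚ q)

_·ₚ_ : ℚ → Poly → Poly
c ·ₚ p = map (c *_) p

_-ₚ_ : Poly → Poly → Poly
p -ₚ q = p +ₚ (- 1ℚ) ·ₚ q

_*ₚ_ : Poly → Poly → Poly
[]      *ₚ q = []
(a ∷ p) *ₚ q = a ·ₚ q +ₚ (0ℚ ∷ p *ₚ q)

-- derivFrom k (a₀ ∷ a₁ ∷ …) = k a₀ ∷ (k+1) a₁ ∷ …
derivFrom : ℕ → Poly → Poly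
derivFrom k []      = []
derivFrom k (a ∷ p) = ℕ→ℚ k * a ∷ derivFrom (suc k) p

deriv : Poly → Poly
deriv []      = []
deriv (a ∷ p) = derivFrom 1 p

eval : Poly → ℝ → ℝ
eval []      y = ℕ→ℝ 0
eval (a ∷ p) y = ℚ→ℝ a +ᴿ y *ᴿ eval p y

-- sum₁ m f = f 1 + f 2 + … + f m
sum₁ : ℕ → (ℕ → Poly) → Poly
sum₁ zero    f = []
sum₁ (suc m) f = sum₁ m f +ₚ f (suc m)

-- Right-hand side of the recurrence for n ≥ 1, as a function of the family
-- Q; it only looks at Q i with i < n.
recurrenceRHS : (n : ℕ) .{{_ : ℕ.NonZero n}} → (ℕ → Poly) → Poly
recurrenceRHS n Q =
  ℕ→ℚ n ·ₚ Q (n ∸ 1) -ₚ deriv (Q (n ∸ 1))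
  +ₚ (+ 1 / n) ·ₚ sum₁ (n ∸ 1) λ k →
       ℕ→ℚ k ·ₚ ((ℕ→ℚ (k ∸ 1) ·ₚ Q (k ∸ 1) -ₚ Q k -ₚ deriv (Q (k ∸ 1))) *ₚ Q (n ∸ k ∸ 1))

-- Course-of-values recursion: table n i is Pᵢ for i ≤ n (junk for i > n).
table : ℕ → ℕ → Poly
table zero    _ = - 1ℚ ∷ 1ℚ ∷ []
table (suc n) i with i ℕₚ.≤? n
... | yes _ = table n i
... | no  _ = recurrenceRHS (suc n) (table n)

P : ℕ → Poly
P n = table n n

private
  table-step : ∀ n → table (suc n) (suc n) ≡ recurrenceRHS (suc n) (table n)
  table-step n with suc n ℕₚ.≤? n
  ... | yes p = contradiction p ℕₚ.1+n≰n
  ... | no  _ = refl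

  table-old : ∀ {n i} → i ℕ.≤ n → table (suc n) i ≡ table n i
  table-old {n} {i} i≤n with i ℕₚ.≤? n
  ... | yes _ = refl
  ... | no ¬p = contradiction i≤n ¬p

  table≡P : ∀ n {i} → i ℕ.≤ n → table n i ≡ P i
  table≡P zero    ℕ.z≤n = refl
  table≡P (suc n) {i} i≤1+n with ℕₚ.m≤n⇒m<n∨m≡n i≤1+n
  ... | inj₂ refl = refl
  ... | inj₁ (ℕ.s≤s i≤n) = trans (table-old i≤n) (table≡P n i≤n)

  sum₁-cong : ∀ m {f g} → (∀ k → k ℕ.≤ m → f k ≡ g k) → sum₁ m f ≡ sum₁ m g
  sum₁-cong zero    h = refl
  sum₁-cong (suc m) h =
    cong₂ _+ₚ_ (sum₁-cong m λ k k≤m → h k (ℕₚ.m≤n⇒m≤1+n k≤m)) (h (suc m) ℕₚ.≤-refl)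

  recurrenceRHS-cong : ∀ n {Q R} → (∀ {i} → i ℕ.≤ n → Q i ≡ R i) →
    recurrenceRHS (suc n) Q ≡ recurrenceRHS (suc n) R
  recurrenceRHS-cong n {Q} {R} h = cong₂ _+ₚ_
    (cong (λ t → ℕ→ℚ (suc n) ·ₚ t -ₚ deriv t) (h ℕₚ.≤-refl))
    (cong ((+ 1 / suc n) ·ₚ_) (sum₁-cong n λ k k≤n →
      cong (ℕ→ℚ k ·ₚ_) (cong₂ _*ₚ_
        (cong₂ (λ t u → ℕ→ℚ (k ∸ 1) ·ₚ t -ₚ u -ₚ deriv t)
          (h (ℕₚ.≤-trans (ℕₚ.m∸n≤m k 1) k≤n)) (h k≤n))
        (h (n∸k k)))))
    where
    n∸k : ∀ k → suc n ∸ k ∸ 1 ℕ.≤ n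
    n∸k k = subst (ℕ._≤ n)
      (trans (cong (suc n ∸_) (ℕₚ.+-comm 1 k)) (sym (ℕₚ.∸-+-assoc (suc n) k 1)))
      (ℕₚ.m∸n≤m n k)

P-zero : P 0 ≡ - 1ℚ ∷ 1ℚ ∷ []
P-zero = refl

P-recurrence : ∀ n .{{_ : ℕ.NonZero n}} → P n ≡ recurrenceRHS n P
P-recurrence (suc n) = trans (table-step n) (recurrenceRHS-cong n (table≡P n))

{-# OPTIONS --safe #-}
-- For a polynomial p = Σ aₖ yᵏ put ‖p‖ = Σ |aₖ| 2ᵏ.  This norm is submultiplicative, 2 ‖p'‖ ≤ d ‖p‖
-- when p has degree at most d, and 2ⁿ |p(y)| ≤ yⁿ ‖p‖ for y ≥ 2 and deg p ≤ n, so it suffices that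
-- ‖Pₙ‖ ≤ 3 n! 2ⁿ.  Writing Bₖ = (k-1) Pₖ₋₁ - Pₖ - P'ₖ₋₁ for the bracket of the recurrence, the
-- recurrence becomes n Bₙ = - (n Pₙ₋₁ + Σ k Bₖ Pₙ₋ₖ₋₁), free of derivatives, and
-- Pₙ = (n-1) Pₙ₋₁ - P'ₙ₋₁ - Bₙ.  The two estimates ‖Pₙ‖ ≤ 3 n! 2ⁿ and
-- 4 n ‖Bₙ‖ ≤ 3 (n+3) n! 2ⁿ then follow by a joint induction from n = 0, 1.
module Submission where

open import Defs

-- The recurrence differentiates, and a pointwise bound on a polynomial says nothing about its
-- derivative, so no induction on |Pₙ(y)| alone can close; a norm on coefficients controls both. The
-- weight is 2 because 2 is the left end of the range of y: for k ≤ n the ratio yᵏ / yⁿ is largest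
-- there, so one number ‖p‖ serves all y ≥ 2 at once. P₀ = y - 1 has degree 1 rather than 0. Hence
-- the degree bound is max(1, n), the derivative estimate is applied only to Pₙ₋₁ with n ≥ 2, and P₀
-- has a pointwise estimate of its own. Everything is proved at rational points first. The passage
-- to reals then has its own difficulty: y ≥ 2 does not make the terms of a sequence for y at least
-- 2.

module _ where
  open import Data.Nat.Base as ℕ using (ℕ; zero; suc; _∸_; _!; z≤n; s≤s)
  import Data.Nat.Properties as ℕₚ
  import Data.Nat.Solver as ℕSolver
  open import Data.Nat.Induction using (<-rec)
  import Data.Integer.Base as ℤ
  import Data.Integer.Properties as ℤₚ
  open import Data.List.Base using ([]; _∷_; length)
  open import Data.List.Properties using (length-map)
  open import Data.Product.Base using (∃; _,_; _×_)
  open import Data.Rational.Base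
  open import Data.Rational.Properties
  open import Data.Rational.Solver using (module +-*-Solver)
  import Data.Rational.Unnormalised.Base as ℚᵘ
  import Data.Rational.Unnormalised.Properties as ℚᵘₚ
  open import Data.Sum.Base using (inj₁; inj₂)
  open import Relation.Binary.PropositionalEquality
  open import Relation.Nullary.Decidable using (toWitness)

  open +-*-Solver using (solve; con; _:=_; _:+_; _:*_; _:-_; :-_)

  open ℕSolver.+-*-Solver using ()
    renaming (solve to solveℕ; con to conℕ; _:+_ to _⊕_; _:*_ to _⊗_; _:=_ to _≔_)

  -- Arithmetic of the embedding of ℕ into ℚ

  fromℚᵘ-+ : ∀ p q → fromℚᵘ (p ℚᵘ.+ q) ≡ fromℚᵘ p + fromℚᵘ q
  fromℚᵘ-+ p q = toℚᵘ-injective (begin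
    toℚᵘ (fromℚᵘ (p ℚᵘ.+ q))                ≈⟨ toℚᵘ-fromℚᵘ (p ℚᵘ.+ q) ⟩
    p ℚᵘ.+ q                                ≈⟨ ℚᵘₚ.+-cong (toℚᵘ-fromℚᵘ p) (toℚᵘ-fromℚᵘ q) ⟨
    toℚᵘ (fromℚᵘ p) ℚᵘ.+ toℚᵘ (fromℚᵘ q)    ≈⟨ toℚᵘ-homo-+ (fromℚᵘ p) (fromℚᵘ q) ⟨
    toℚᵘ (fromℚᵘ p + fromℚᵘ q)              ∎)
    where open ℚᵘₚ.≃-Reasoning

  fromℚᵘ-* : ∀ p q → fromℚᵘ (p ℚᵘ.* q) ≡ fromℚᵘ p * fromℚᵘ q
  fromℚᵘ-* p q = toℚᵘ-injective (begin
    toℚᵘ (fromℚᵘ (p ℚᵘ.* q))                ≈⟨ toℚᵘ-fromℚᵘ (p ℚᵘ.* q) ⟩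
    p ℚᵘ.* q                                ≈⟨ ℚᵘₚ.*-cong (toℚᵘ-fromℚᵘ p) (toℚᵘ-fromℚᵘ q) ⟨
    toℚᵘ (fromℚᵘ p) ℚᵘ.* toℚᵘ (fromℚᵘ q)    ≈⟨ toℚᵘ-homo-* (fromℚᵘ p) (fromℚᵘ q) ⟨
    toℚᵘ (fromℚᵘ p * fromℚᵘ q)              ∎)
    where open ℚᵘₚ.≃-Reasoning

  -- The quotient `+ n / 1` is normalised through a gcd and does not reduce for a variable `n`;
  -- among unnormalised fractions the identity is plain integer arithmetic.
  ℕ→ℚ-+ : ∀ m n → ℕ→ℚ (m ℕ.+ n) ≡ ℕ→ℚ m + ℕ→ℚ n
  ℕ→ℚ-+ m n = trans
    (fromℚᵘ-cong {ℚᵘ.mkℚᵘ (ℤ.+ (m ℕ.+ n)) 0} {ℚᵘ.mkℚᵘ (ℤ.+ m) 0 ℚᵘ.+ ℚᵘ.mkℚᵘ (ℤ.+ n) 0}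
      (ℚᵘ.*≡* (cong (ℤ._* ℤ.+ 1) (sym (cong₂ ℤ._+_ (ℤₚ.*-identityʳ (ℤ.+ m)) (ℤₚ.*-identityʳ (ℤ.+ n)))))))
    (fromℚᵘ-+ (ℚᵘ.mkℚᵘ (ℤ.+ m) 0) (ℚᵘ.mkℚᵘ (ℤ.+ n) 0))

  ℕ→ℚ-* : ∀ m n → ℕ→ℚ (m ℕ.* n) ≡ ℕ→ℚ m * ℕ→ℚ n
  ℕ→ℚ-* m n = trans
    (fromℚᵘ-cong {ℚᵘ.mkℚᵘ (ℤ.+ (m ℕ.* n)) 0} {ℚᵘ.mkℚᵘ (ℤ.+ m) 0 ℚᵘ.* ℚᵘ.mkℚᵘ (ℤ.+ n) 0}
      (ℚᵘ.*≡* (cong (ℤ._* ℤ.+ 1) (ℤₚ.pos-* m n))))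
    (fromℚᵘ-* (ℚᵘ.mkℚᵘ (ℤ.+ m) 0) (ℚᵘ.mkℚᵘ (ℤ.+ n) 0))

  0≤ℕ→ℚ : ∀ n → 0ℚ ≤ ℕ→ℚ n
  0≤ℕ→ℚ n = nonNegative⁻¹ (ℕ→ℚ n) {{normalize-nonNeg n 1}}

  ℕ→ℚ-*-monoʳ-≤ : ∀ n {p q} → p ≤ q → ℕ→ℚ n * p ≤ ℕ→ℚ n * q
  ℕ→ℚ-*-monoʳ-≤ n = *-monoˡ-≤-nonNeg (ℕ→ℚ n) {{normalize-nonNeg n 1}}

  ℕ→ℚ-mono-≤ : ∀ {m n} → m ℕ.≤ n → ℕ→ℚ m ≤ ℕ→ℚ n
  ℕ→ℚ-mono-≤ {m} {n} m≤n = begin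
    ℕ→ℚ m                    ≡⟨ +-identityʳ (ℕ→ℚ m) ⟨
    ℕ→ℚ m + 0ℚ               ≤⟨ +-monoʳ-≤ (ℕ→ℚ m) (0≤ℕ→ℚ (n ∸ m)) ⟩
    ℕ→ℚ m + ℕ→ℚ (n ∸ m)      ≡⟨ ℕ→ℚ-+ m (n ∸ m) ⟨
    ℕ→ℚ (m ℕ.+ (n ∸ m))      ≡⟨ cong ℕ→ℚ (ℕₚ.m+[n∸m]≡n m≤n) ⟩
    ℕ→ℚ n                    ∎
    where open ≤-Reasoning

  n*[1/n]≡1 : ∀ n .{{_ : ℕ.NonZero n}} → ℕ→ℚ n * (ℤ.+ 1 / n) ≡ 1ℚ
  n*[1/n]≡1 (suc n) = trans
    (sym (fromℚᵘ-* (ℚᵘ.mkℚᵘ (ℤ.+ suc n) 0) (ℚᵘ.mkℚᵘ (ℤ.+ 1) n)))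
    (fromℚᵘ-cong {ℚᵘ.mkℚᵘ (ℤ.+ suc n) 0 ℚᵘ.* ℚᵘ.mkℚᵘ (ℤ.+ 1) n} {ℚᵘ.1ℚᵘ}
      (ℚᵘ.*≡* (trans (ℤₚ.*-identityʳ _) (trans (ℤₚ.*-identityʳ _)
        (sym (trans (ℤₚ.*-identityˡ _) (cong ℤ.+_ (ℕₚ.*-identityˡ (suc n)))))))))

  *-mono-≤-nonNeg : ∀ {p q r s} → 0ℚ ≤ q → 0ℚ ≤ r → p ≤ q → r ≤ s → p * r ≤ q * s
  *-mono-≤-nonNeg {p} {q} {r} {s} 0≤q 0≤r p≤q r≤s = ≤-trans
    (*-monoʳ-≤-nonNeg r {{nonNegative 0≤r}} p≤q)
    (*-monoˡ-≤-nonNeg q {{nonNegative 0≤q}} r≤s)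

  0≤* : ∀ {p q} → 0ℚ ≤ p → 0ℚ ≤ q → 0ℚ ≤ p * q
  0≤* {p} {q} 0≤p 0≤q =
    nonNegative⁻¹ (p * q) {{nonNeg*nonNeg⇒nonNeg p {{nonNegative 0≤p}} q {{nonNegative 0≤q}}}}

  -- Coefficients and the weighted norm

  coeff : Poly → ℕ → ℚ
  coeff []      i       = 0ℚ
  coeff (a ∷ p) zero    = a
  coeff (a ∷ p) (suc i) = coeff p i

  coeff-+ : ∀ p q i → coeff (p +ₚ q) i ≡ coeff p i + coeff q i
  coeff-+ []      q       i       = sym (+-identityˡ (coeff q i))
  coeff-+ (a ∷ p) []      i       = sym (+-identityʳ (coeff (a ∷ p) i))
  coeff-+ (a ∷ p) (b ∷ q) zero    = refl
  coeff-+ (a ∷ p) (b ∷ q) (suc i) = coeff-+ p q i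

  coeff-· : ∀ c p i → coeff (c ·ₚ p) i ≡ c * coeff p i
  coeff-· c []      i       = sym (*-zeroʳ c)
  coeff-· c (a ∷ p) zero    = refl
  coeff-· c (a ∷ p) (suc i) = coeff-· c p i

  coeff-- : ∀ p q i → coeff (p -ₚ q) i ≡ coeff p i - coeff q i
  coeff-- p q i = trans (coeff-+ p _ i) (cong (coeff p i +_)
    (trans (coeff-· (- 1ℚ) q i) (-1*a≡-a (coeff q i))))
    where
    -1*a≡-a : ∀ a → (- 1ℚ) * a ≡ - a
    -1*a≡-a = solve 1 (λ a → con (- 1ℚ) :* a := :- a) refl

  ⟦_⟧ : Poly → ℚ
  ⟦ [] ⟧    = 0ℚ
  ⟦ a ∷ p ⟧ = ∣ a ∣ + ℕ→ℚ 2 * ⟦ p ⟧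

  0≤⟦_⟧ : ∀ p → 0ℚ ≤ ⟦ p ⟧
  0≤⟦ [] ⟧    = ≤-refl
  0≤⟦ a ∷ p ⟧ = +-mono-≤ (0≤∣p∣ a) (ℕ→ℚ-*-monoʳ-≤ 2 0≤⟦ p ⟧)

  -- Lists with different trailing zeros denote the same polynomial, so polynomial identities are
  -- checked coefficientwise and reach the norm through this lemma.
  ‖‖-cong : ∀ p q → (∀ i → coeff p i ≡ coeff q i) → ⟦ p ⟧ ≡ ⟦ q ⟧
  ‖‖-cong []      []      h = refl
  -- The norm of `[]` is `0ℚ`, to which `∣ 0ℚ ∣ + ℕ→ℚ 2 * 0ℚ` computes, so `[]` can be treated as
  -- `0ℚ ∷ []`.
  ‖‖-cong []      (b ∷ q) h = cong₂ (λ x y → ∣ x ∣ + ℕ→ℚ 2 * y) (h 0) (‖‖-cong [] q (λ i → h (suc i)))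
  ‖‖-cong (a ∷ p) []      h = cong₂ (λ x y → ∣ x ∣ + ℕ→ℚ 2 * y) (h 0) (‖‖-cong p [] (λ i → h (suc i)))
  ‖‖-cong (a ∷ p) (b ∷ q) h = cong₂ (λ x y → ∣ x ∣ + ℕ→ℚ 2 * y) (h 0) (‖‖-cong p q (λ i → h (suc i)))

  ‖p+q‖≤‖p‖+‖q‖ : ∀ p q → ⟦ p +ₚ q ⟧ ≤ ⟦ p ⟧ + ⟦ q ⟧
  ‖p+q‖≤‖p‖+‖q‖ []      q       = ≤-reflexive (sym (+-identityˡ ⟦ q ⟧))
  ‖p+q‖≤‖p‖+‖q‖ (a ∷ p) []      = ≤-reflexive (sym (+-identityʳ ⟦ a ∷ p ⟧))
  ‖p+q‖≤‖p‖+‖q‖ (a ∷ p) (b ∷ q) = begin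
    ∣ a + b ∣ + ℕ→ℚ 2 * ⟦ p +ₚ q ⟧
      ≤⟨ +-mono-≤ (∣p+q∣≤∣p∣+∣q∣ a b) (ℕ→ℚ-*-monoʳ-≤ 2 (‖p+q‖≤‖p‖+‖q‖ p q)) ⟩
    (∣ a ∣ + ∣ b ∣) + ℕ→ℚ 2 * (⟦ p ⟧ + ⟦ q ⟧)
      ≡⟨ regroup ∣ a ∣ ∣ b ∣ (ℕ→ℚ 2) ⟦ p ⟧ ⟦ q ⟧ ⟩
    ⟦ a ∷ p ⟧ + ⟦ b ∷ q ⟧ ∎
    where
    open ≤-Reasoning
    regroup : ∀ a b c x y → (a + b) + c * (x + y) ≡ (a + c * x) + (b + c * y)
    regroup = solve 5 (λ a b c x y → (a :+ b) :+ c :* (x :+ y) := (a :+ c :* x) :+ (b :+ c :* y)) refl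

  ‖c·p‖≡∣c∣‖p‖ : ∀ c p → ⟦ c ·ₚ p ⟧ ≡ ∣ c ∣ * ⟦ p ⟧
  ‖c·p‖≡∣c∣‖p‖ c []      = sym (*-zeroʳ ∣ c ∣)
  ‖c·p‖≡∣c∣‖p‖ c (a ∷ p) = begin
    ∣ c * a ∣ + ℕ→ℚ 2 * ⟦ c ·ₚ p ⟧          ≡⟨ cong₂ (λ x y → x + ℕ→ℚ 2 * y) (∣p*q∣≡∣p∣*∣q∣ c a) (‖c·p‖≡∣c∣‖p‖ c p) ⟩
    ∣ c ∣ * ∣ a ∣ + ℕ→ℚ 2 * (∣ c ∣ * ⟦ p ⟧) ≡⟨ factor ∣ c ∣ ∣ a ∣ (ℕ→ℚ 2) ⟦ p ⟧ ⟩
    ∣ c ∣ * ⟦ a ∷ p ⟧                       ∎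
    where
    open ≡-Reasoning
    factor : ∀ c a d x → c * a + d * (c * x) ≡ c * (a + d * x)
    factor = solve 4 (λ c a d x → c :* a :+ d :* (c :* x) := c :* (a :+ d :* x)) refl

  ∣ℕ→ℚ∣ : ∀ n → ∣ ℕ→ℚ n ∣ ≡ ℕ→ℚ n
  ∣ℕ→ℚ∣ n = 0≤p⇒∣p∣≡p (0≤ℕ→ℚ n)

  ‖n·p‖≡n‖p‖ : ∀ n p → ⟦ ℕ→ℚ n ·ₚ p ⟧ ≡ ℕ→ℚ n * ⟦ p ⟧
  ‖n·p‖≡n‖p‖ n p = trans (‖c·p‖≡∣c∣‖p‖ (ℕ→ℚ n) p) (cong (_* ⟦ p ⟧) (∣ℕ→ℚ∣ n))

  ‖p-q‖≤‖p‖+‖q‖ : ∀ p q → ⟦ p -ₚ q ⟧ ≤ ⟦ p ⟧ + ⟦ q ⟧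
  ‖p-q‖≤‖p‖+‖q‖ p q = ≤-trans (‖p+q‖≤‖p‖+‖q‖ p _)
    (≤-reflexive (cong (⟦ p ⟧ +_) (trans (‖c·p‖≡∣c∣‖p‖ (- 1ℚ) q) (*-identityˡ ⟦ q ⟧))))

  ‖p*q‖≤‖p‖*‖q‖ : ∀ p q → ⟦ p *ₚ q ⟧ ≤ ⟦ p ⟧ * ⟦ q ⟧
  ‖p*q‖≤‖p‖*‖q‖ []      q = ≤-reflexive (sym (*-zeroˡ ⟦ q ⟧))
  ‖p*q‖≤‖p‖*‖q‖ (a ∷ p) q = begin
    ⟦ a ·ₚ q +ₚ (0ℚ ∷ p *ₚ q) ⟧                    ≤⟨ ‖p+q‖≤‖p‖+‖q‖ (a ·ₚ q) _ ⟩
    ⟦ a ·ₚ q ⟧ + (0ℚ + ℕ→ℚ 2 * ⟦ p *ₚ q ⟧)         ≡⟨ cong (_+ (0ℚ + ℕ→ℚ 2 * ⟦ p *ₚ q ⟧)) (‖c·p‖≡∣c∣‖p‖ a q) ⟩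
    ∣ a ∣ * ⟦ q ⟧ + (0ℚ + ℕ→ℚ 2 * ⟦ p *ₚ q ⟧)      ≤⟨ +-monoʳ-≤ (∣ a ∣ * ⟦ q ⟧) (+-monoʳ-≤ 0ℚ
                                                       (ℕ→ℚ-*-monoʳ-≤ 2 (‖p*q‖≤‖p‖*‖q‖ p q))) ⟩
    ∣ a ∣ * ⟦ q ⟧ + (0ℚ + ℕ→ℚ 2 * (⟦ p ⟧ * ⟦ q ⟧)) ≡⟨ factor ∣ a ∣ ⟦ q ⟧ (ℕ→ℚ 2) ⟦ p ⟧ ⟩
    ⟦ a ∷ p ⟧ * ⟦ q ⟧                              ∎
    where
    open ≤-Reasoning
    factor : ∀ a y c x → a * y + (0ℚ + c * (x * y)) ≡ (a + c * x) * y
    factor = solve 4 (λ a y c x → a :* y :+ (con 0ℚ :+ c :* (x :* y)) := (a :+ c :* x) :* y) refl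

  -- The multipliers run from `k` to `k + length p - 1`, and the hypothesis says that the last of
  -- them is at most `d`.
  ‖derivFrom‖≤ : ∀ k d p → k ℕ.+ length p ℕ.≤ suc d → ⟦ derivFrom k p ⟧ ≤ ℕ→ℚ d * ⟦ p ⟧
  ‖derivFrom‖≤ k d []      h = ≤-reflexive (sym (*-zeroʳ (ℕ→ℚ d)))
  ‖derivFrom‖≤ k d (a ∷ p) h = begin
    ∣ ℕ→ℚ k * a ∣ + ℕ→ℚ 2 * ⟦ derivFrom (suc k) p ⟧
      ≤⟨ +-mono-≤
           (≤-trans (≤-reflexive (trans (∣p*q∣≡∣p∣*∣q∣ (ℕ→ℚ k) a) (cong (_* ∣ a ∣) (∣ℕ→ℚ∣ k))))
             (*-monoʳ-≤-nonNeg ∣ a ∣ {{∣-∣-nonNeg a}} (ℕ→ℚ-mono-≤ (ℕₚ.≤-trans (ℕₚ.m≤m+n k _) (ℕ.s≤s⁻¹ h′)))))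
           (ℕ→ℚ-*-monoʳ-≤ 2 (‖derivFrom‖≤ (suc k) d p h′)) ⟩
    ℕ→ℚ d * ∣ a ∣ + ℕ→ℚ 2 * (ℕ→ℚ d * ⟦ p ⟧)
      ≡⟨ factor (ℕ→ℚ d) ∣ a ∣ (ℕ→ℚ 2) ⟦ p ⟧ ⟩
    ℕ→ℚ d * ⟦ a ∷ p ⟧ ∎
    where
    open ≤-Reasoning
    h′ : suc k ℕ.+ length p ℕ.≤ suc d
    h′ = subst (ℕ._≤ suc d) (ℕₚ.+-suc k (length p)) h
    factor : ∀ c a d x → c * a + d * (c * x) ≡ c * (a + d * x)
    factor = solve 4 (λ c a d x → c :* a :+ d :* (c :* x) := c :* (a :+ d :* x)) refl

  -- Differentiation moves each coefficient down one place, where its weight is half as large; this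
  -- is the factor 2 on the left.
  2‖deriv‖≤d‖p‖ : ∀ d p → length p ℕ.≤ suc d → ℕ→ℚ 2 * ⟦ deriv p ⟧ ≤ ℕ→ℚ d * ⟦ p ⟧
  2‖deriv‖≤d‖p‖ d []      h = ≤-reflexive (sym (*-zeroʳ (ℕ→ℚ d)))
  2‖deriv‖≤d‖p‖ d (a ∷ p) h = begin
    ℕ→ℚ 2 * ⟦ derivFrom 1 p ⟧             ≤⟨ ℕ→ℚ-*-monoʳ-≤ 2 (‖derivFrom‖≤ 1 d p h) ⟩
    ℕ→ℚ 2 * (ℕ→ℚ d * ⟦ p ⟧)               ≡⟨ swap (ℕ→ℚ 2) (ℕ→ℚ d) ⟦ p ⟧ ⟩
    ℕ→ℚ d * (0ℚ + ℕ→ℚ 2 * ⟦ p ⟧)          ≤⟨ ℕ→ℚ-*-monoʳ-≤ d (+-monoˡ-≤ (ℕ→ℚ 2 * ⟦ p ⟧) (0≤∣p∣ a)) ⟩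
    ℕ→ℚ d * ⟦ a ∷ p ⟧                     ∎
    where
    open ≤-Reasoning
    swap : ∀ c d x → c * (d * x) ≡ d * (0ℚ + c * x)
    swap = solve 3 (λ c d x → c :* (d :* x) := d :* (con 0ℚ :+ c :* x)) refl

  ‖sum₁‖≤ : ∀ c Y m f → (∀ k → 1 ℕ.≤ k → k ℕ.≤ m → ℕ→ℚ c * ⟦ f k ⟧ ≤ ℕ→ℚ Y) →
    ℕ→ℚ c * ⟦ sum₁ m f ⟧ ≤ ℕ→ℚ (m ℕ.* Y)
  ‖sum₁‖≤ c Y zero    f h = ≤-reflexive (*-zeroʳ (ℕ→ℚ c))
  ‖sum₁‖≤ c Y (suc m) f h = begin
    ℕ→ℚ c * ⟦ sum₁ m f +ₚ f (suc m) ⟧                   ≤⟨ ℕ→ℚ-*-monoʳ-≤ c (‖p+q‖≤‖p‖+‖q‖ (sum₁ m f) _) ⟩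
    ℕ→ℚ c * (⟦ sum₁ m f ⟧ + ⟦ f (suc m) ⟧)              ≡⟨ *-distribˡ-+ (ℕ→ℚ c) _ _ ⟩
    ℕ→ℚ c * ⟦ sum₁ m f ⟧ + ℕ→ℚ c * ⟦ f (suc m) ⟧        ≤⟨ +-mono-≤
                                                             (‖sum₁‖≤ c Y m f (λ k 1≤k k≤m → h k 1≤k (ℕₚ.m≤n⇒m≤1+n k≤m)))
                                                             (h (suc m) (s≤s z≤n) ℕₚ.≤-refl) ⟩
    ℕ→ℚ (m ℕ.* Y) + ℕ→ℚ Y                               ≡⟨ +-comm (ℕ→ℚ (m ℕ.* Y)) (ℕ→ℚ Y) ⟩
    ℕ→ℚ Y + ℕ→ℚ (m ℕ.* Y)                               ≡⟨ ℕ→ℚ-+ Y (m ℕ.* Y) ⟨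
    ℕ→ℚ (suc m ℕ.* Y)                                   ∎
    where open ≤-Reasoning

  -- Degree bounds, expressed by list lengths

  length-+ₚ : ∀ {n} p q → length p ℕ.≤ n → length q ℕ.≤ n → length (p +ₚ q) ℕ.≤ n
  length-+ₚ []      q       hp       hq       = hq
  length-+ₚ (a ∷ p) []      hp       hq       = hp
  length-+ₚ (a ∷ p) (b ∷ q) (s≤s hp) (s≤s hq) = s≤s (length-+ₚ p q hp hq)

  length-·ₚ : ∀ {n} c p → length p ℕ.≤ n → length (c ·ₚ p) ℕ.≤ n
  length-·ₚ c p h = subst (ℕ._≤ _) (sym (length-map (c *_) p)) h

  length--ₚ : ∀ {n} p q → length p ℕ.≤ n → length q ℕ.≤ n → length (p -ₚ q) ℕ.≤ n
  length--ₚ p q hp hq = length-+ₚ p _ hp (length-·ₚ (- 1ℚ) q hq)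

  length-derivFrom : ∀ k p → length (derivFrom k p) ≡ length p
  length-derivFrom k []      = refl
  length-derivFrom k (a ∷ p) = cong suc (length-derivFrom (suc k) p)

  length-deriv : ∀ {n} p → length p ℕ.≤ n → length (deriv p) ℕ.≤ n
  length-deriv []      h = h
  length-deriv (a ∷ p) h =
    subst (ℕ._≤ _) (sym (length-derivFrom 1 p)) (ℕₚ.≤-trans (ℕₚ.n≤1+n (length p)) h)

  length-*ₚ : ∀ {l m} p q → length p ℕ.≤ suc l → length q ℕ.≤ suc m → length (p *ₚ q) ℕ.≤ suc (l ℕ.+ m)
  length-*ₚ []      q hp hq = z≤n
  length-*ₚ {zero}  (a ∷ [])    q hp hq = length-+ₚ (a ·ₚ q) _ (length-·ₚ a q hq) (s≤s z≤n)
  length-*ₚ {zero}  (a ∷ b ∷ p) q (s≤s ()) hq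
  length-*ₚ {suc l} {m} (a ∷ p) q (s≤s hp) hq = length-+ₚ (a ·ₚ q) _
    (ℕₚ.≤-trans (length-·ₚ a q hq) (s≤s (ℕₚ.m≤n+m m (suc l))))
    (s≤s (length-*ₚ p q hp hq))

  length-sum₁ : ∀ {n} m f → (∀ k → 1 ℕ.≤ k → k ℕ.≤ m → length (f k) ℕ.≤ n) → length (sum₁ m f) ℕ.≤ n
  length-sum₁ zero    f h = z≤n
  length-sum₁ (suc m) f h = length-+ₚ (sum₁ m f) (f (suc m))
    (length-sum₁ m f (λ k 1≤k k≤m → h k 1≤k (ℕₚ.m≤n⇒m≤1+n k≤m)))
    (h (suc m) (s≤s z≤n) ℕₚ.≤-refl)

  -- The recurrence rewritten with brackets

  bracket : ℕ → Poly
  bracket k = ℕ→ℚ (k ∸ 1) ·ₚ P (k ∸ 1) -ₚ P k -ₚ deriv (P (k ∸ 1))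

  -- Definitionally the sum inside `recurrenceRHS n P`, so `P-recurrence` applies to it as it
  -- stands.
  convolution : ℕ → Poly
  convolution n = sum₁ (n ∸ 1) λ k → ℕ→ℚ k ·ₚ (bracket k *ₚ P (n ∸ k ∸ 1))

  complement : ∀ t i → i ℕ.≤ t → suc (suc t) ∸ suc i ∸ 1 ≡ t ∸ i
  complement t i i≤t = cong (_∸ 1) (ℕₚ.+-∸-assoc 1 i≤t)

  -- The extra degree of P₀ does not accumulate: `bracket k` has degree at most k and P at n - k - 1
  -- has degree at most n - k, so each product stays within degree n.
  length-P : ∀ n → length (P n) ℕ.≤ suc (1 ℕ.⊔ n)
  length-P = <-rec _ step
    where
    step : ∀ n → (∀ {m} → m ℕ.< n → length (P m) ℕ.≤ suc (1 ℕ.⊔ m)) → length (P n) ℕ.≤ suc (1 ℕ.⊔ n)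
    step zero          rec = ℕₚ.≤-refl
    step (suc zero)    rec = ℕₚ.≤-refl
    step (suc (suc t)) rec = subst (λ p → length p ℕ.≤ 3 ℕ.+ t) (sym (P-recurrence (suc (suc t))))
      (length-+ₚ (ℕ→ℚ (2 ℕ.+ t) ·ₚ P (suc t) -ₚ deriv (P (suc t))) _
        (length--ₚ (ℕ→ℚ (2 ℕ.+ t) ·ₚ P (suc t)) _ (length-·ₚ (ℕ→ℚ (2 ℕ.+ t)) (P (suc t)) pred) (length-deriv (P (suc t)) pred))
        (length-·ₚ (ℤ.+ 1 / (2 ℕ.+ t)) (convolution (2 ℕ.+ t)) (length-sum₁ (suc t) _ summand)))
      where
      weak : ∀ {m} → m ℕ.< 2 ℕ.+ t → length (P m) ℕ.≤ 2 ℕ.+ m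
      weak m< = ℕₚ.≤-trans (rec m<) (s≤s (ℕₚ.⊔-lub (s≤s z≤n) (ℕₚ.n≤1+n _)))
      pred : length (P (suc t)) ℕ.≤ 3 ℕ.+ t
      pred = weak ℕₚ.≤-refl
      summand : ∀ k → 1 ℕ.≤ k → k ℕ.≤ suc t →
        length (ℕ→ℚ k ·ₚ (bracket k *ₚ P (2 ℕ.+ t ∸ k ∸ 1))) ℕ.≤ 3 ℕ.+ t
      summand (suc i) _ (s≤s i≤t) rewrite complement t i i≤t =
        length-·ₚ (ℕ→ℚ (suc i)) (bracket (suc i) *ₚ P (t ∸ i)) (subst (length (bracket (suc i) *ₚ P (t ∸ i)) ℕ.≤_) total
          (length-*ₚ {suc i} {suc (t ∸ i)} (bracket (suc i)) _
            (length--ₚ (ℕ→ℚ i ·ₚ P i -ₚ P (suc i)) _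
              (length--ₚ (ℕ→ℚ i ·ₚ P i) (P (suc i))
                (length-·ₚ (ℕ→ℚ i) (P i) Pi) (rec (s≤s (s≤s i≤t))))
              (length-deriv (P i) Pi))
            (weak (s≤s (ℕₚ.≤-trans (ℕₚ.m∸n≤m t i) (ℕₚ.n≤1+n t))))))
        where
        Pi : length (P i) ℕ.≤ 2 ℕ.+ i
        Pi = weak (s≤s (ℕₚ.≤-trans i≤t (ℕₚ.n≤1+n t)))
        total : suc (suc i ℕ.+ suc (t ∸ i)) ≡ 3 ℕ.+ t
        total = cong (λ m → suc (suc m)) (trans (ℕₚ.+-suc i (t ∸ i)) (cong suc (ℕₚ.m+[n∸m]≡n i≤t)))

  coeff-P : ∀ n i → coeff (P (suc n)) i ≡
    ℕ→ℚ (suc n) * coeff (P n) i - coeff (deriv (P n)) i + (ℤ.+ 1 / suc n) * coeff (convolution (suc n)) i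
  coeff-P n i = begin
    coeff (P (suc n)) i
      ≡⟨ cong (λ p → coeff p i) (P-recurrence (suc n)) ⟩
    coeff (ℕ→ℚ (suc n) ·ₚ P n -ₚ deriv (P n) +ₚ (ℤ.+ 1 / suc n) ·ₚ convolution (suc n)) i
      ≡⟨ coeff-+ (ℕ→ℚ (suc n) ·ₚ P n -ₚ deriv (P n)) _ i ⟩
    coeff (ℕ→ℚ (suc n) ·ₚ P n -ₚ deriv (P n)) i + coeff ((ℤ.+ 1 / suc n) ·ₚ convolution (suc n)) i
      ≡⟨ cong₂ _+_ (coeff-- (ℕ→ℚ (suc n) ·ₚ P n) (deriv (P n)) i) (coeff-· (ℤ.+ 1 / suc n) (convolution (suc n)) i) ⟩
    coeff (ℕ→ℚ (suc n) ·ₚ P n) i - coeff (deriv (P n)) i + (ℤ.+ 1 / suc n) * coeff (convolution (suc n)) i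
      ≡⟨ cong (λ x → x - coeff (deriv (P n)) i + (ℤ.+ 1 / suc n) * coeff (convolution (suc n)) i)
           (coeff-· (ℕ→ℚ (suc n)) (P n) i) ⟩
    ℕ→ℚ (suc n) * coeff (P n) i - coeff (deriv (P n)) i + (ℤ.+ 1 / suc n) * coeff (convolution (suc n)) i ∎
    where open ≡-Reasoning

  coeff-bracket : ∀ n i → coeff (bracket (suc n)) i ≡
    ℕ→ℚ n * coeff (P n) i - coeff (P (suc n)) i - coeff (deriv (P n)) i
  coeff-bracket n i = trans (coeff-- (ℕ→ℚ n ·ₚ P n -ₚ P (suc n)) (deriv (P n)) i)
    (cong (_- coeff (deriv (P n)) i) (trans (coeff-- (ℕ→ℚ n ·ₚ P n) (P (suc n)) i)
      (cong (_- coeff (P (suc n)) i) (coeff-· (ℕ→ℚ n) (P n) i))))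

  -- With S the convolution at index n + 1, the recurrence says Pₙ₊₁ + P'ₙ = (n+1) Pₙ + S/(n+1).
  -- Inserted into the bracket it removes the derivative and leaves -Pₙ - S/(n+1).
  n‖bracket‖≤ : ∀ n → ℕ→ℚ (suc n) * ⟦ bracket (suc n) ⟧ ≤ ℕ→ℚ (suc n) * ⟦ P n ⟧ + ⟦ convolution (suc n) ⟧
  n‖bracket‖≤ n = begin
    N * ⟦ bracket (suc n) ⟧                   ≡⟨ ‖n·p‖≡n‖p‖ (suc n) (bracket (suc n)) ⟨
    ⟦ N ·ₚ bracket (suc n) ⟧                  ≡⟨ ‖‖-cong (N ·ₚ bracket (suc n)) ((- 1ℚ) ·ₚ (N ·ₚ P n +ₚ convolution (suc n))) coeffs ⟩
    ⟦ (- 1ℚ) ·ₚ (N ·ₚ P n +ₚ convolution (suc n)) ⟧ ≡⟨ ‖c·p‖≡∣c∣‖p‖ (- 1ℚ) (N ·ₚ P n +ₚ convolution (suc n)) ⟩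
    1ℚ * ⟦ N ·ₚ P n +ₚ convolution (suc n) ⟧  ≡⟨ *-identityˡ _ ⟩
    ⟦ N ·ₚ P n +ₚ convolution (suc n) ⟧       ≤⟨ ‖p+q‖≤‖p‖+‖q‖ (N ·ₚ P n) _ ⟩
    ⟦ N ·ₚ P n ⟧ + ⟦ convolution (suc n) ⟧    ≡⟨ cong (_+ ⟦ convolution (suc n) ⟧) (‖n·p‖≡n‖p‖ (suc n) (P n)) ⟩
    N * ⟦ P n ⟧ + ⟦ convolution (suc n) ⟧     ∎
    where
    open ≤-Reasoning
    N r : ℚ
    N = ℕ→ℚ (suc n)
    r = ℤ.+ 1 / suc n
    -- The ring solver knows neither that the cast of `suc n` is `1ℚ + m` nor that `r` is its
    -- inverse. The first enters by substitution, and the product `(1ℚ + m) * r` is kept together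
    -- for the second.
    cancel : ∀ m x d r s → (1ℚ + m) * (m * x - ((1ℚ + m) * x - d + r * s) - d) ≡
      (- 1ℚ) * ((1ℚ + m) * x + ((1ℚ + m) * r) * s)
    cancel = solve 5 (λ m x d r s →
      (con 1ℚ :+ m) :* (m :* x :- ((con 1ℚ :+ m) :* x :- d :+ r :* s) :- d) :=
      con (- 1ℚ) :* ((con 1ℚ :+ m) :* x :+ ((con 1ℚ :+ m) :* r) :* s)) refl
    coeffs : ∀ i → coeff (N ·ₚ bracket (suc n)) i ≡ coeff ((- 1ℚ) ·ₚ (N ·ₚ P n +ₚ convolution (suc n))) i
    coeffs i = begin-equality
      coeff (N ·ₚ bracket (suc n)) i             ≡⟨ coeff-· N (bracket (suc n)) i ⟩
      N * coeff (bracket (suc n)) i              ≡⟨ cong (N *_) (coeff-bracket n i) ⟩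
      N * (ℕ→ℚ n * x - coeff (P (suc n)) i - d)  ≡⟨ cong (λ y → N * (ℕ→ℚ n * x - y - d)) (coeff-P n i) ⟩
      N * (ℕ→ℚ n * x - (N * x - d + r * s) - d)  ≡⟨ subst
        (λ N → N * (ℕ→ℚ n * x - (N * x - d + r * s) - d) ≡ (- 1ℚ) * (N * x + (N * r) * s))
        (sym (ℕ→ℚ-+ 1 n)) (cancel (ℕ→ℚ n) x d r s) ⟩
      (- 1ℚ) * (N * x + (N * r) * s)             ≡⟨ cong (λ y → (- 1ℚ) * (N * x + y * s)) (n*[1/n]≡1 (suc n)) ⟩
      (- 1ℚ) * (N * x + 1ℚ * s)                  ≡⟨ cong (λ y → (- 1ℚ) * (N * x + y)) (*-identityˡ s) ⟩
      (- 1ℚ) * (N * x + s)                       ≡⟨ cong (λ y → (- 1ℚ) * (y + s)) (coeff-· N (P n) i) ⟨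
      (- 1ℚ) * (coeff (N ·ₚ P n) i + s)          ≡⟨ cong ((- 1ℚ) *_) (coeff-+ (N ·ₚ P n) _ i) ⟨
      (- 1ℚ) * coeff (N ·ₚ P n +ₚ convolution (suc n)) i ≡⟨ coeff-· (- 1ℚ) (N ·ₚ P n +ₚ convolution (suc n)) i ⟨
      coeff ((- 1ℚ) ·ₚ (N ·ₚ P n +ₚ convolution (suc n))) i ∎
      where
      x d s : ℚ
      x = coeff (P n) i
      d = coeff (deriv (P n)) i
      s = coeff (convolution (suc n)) i

  -- This is the definition of `bracket (suc n)` solved for `P (suc n)`; the recurrence enters the
  -- norm estimates only through `n‖bracket‖≤`.
  ‖P[1+n]‖≤ : ∀ n → ⟦ P (suc n) ⟧ ≤ ℕ→ℚ n * ⟦ P n ⟧ + ⟦ deriv (P n) ⟧ + ⟦ bracket (suc n) ⟧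
  ‖P[1+n]‖≤ n = begin
    ⟦ P (suc n) ⟧
      ≡⟨ ‖‖-cong (P (suc n)) (ℕ→ℚ n ·ₚ P n -ₚ deriv (P n) -ₚ bracket (suc n)) coeffs ⟩
    ⟦ ℕ→ℚ n ·ₚ P n -ₚ deriv (P n) -ₚ bracket (suc n) ⟧
      ≤⟨ ‖p-q‖≤‖p‖+‖q‖ (ℕ→ℚ n ·ₚ P n -ₚ deriv (P n)) _ ⟩
    ⟦ ℕ→ℚ n ·ₚ P n -ₚ deriv (P n) ⟧ + ⟦ bracket (suc n) ⟧
      ≤⟨ +-monoˡ-≤ _ (‖p-q‖≤‖p‖+‖q‖ (ℕ→ℚ n ·ₚ P n) _) ⟩
    ⟦ ℕ→ℚ n ·ₚ P n ⟧ + ⟦ deriv (P n) ⟧ + ⟦ bracket (suc n) ⟧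
      ≡⟨ cong (λ x → x + ⟦ deriv (P n) ⟧ + ⟦ bracket (suc n) ⟧) (‖n·p‖≡n‖p‖ n (P n)) ⟩
    ℕ→ℚ n * ⟦ P n ⟧ + ⟦ deriv (P n) ⟧ + ⟦ bracket (suc n) ⟧ ∎
    where
    open ≤-Reasoning
    rearrange : ∀ m y d → y ≡ m - d - (m - y - d)
    rearrange = solve 3 (λ m y d → y := m :- d :- (m :- y :- d)) refl
    coeffs : ∀ i → coeff (P (suc n)) i ≡ coeff (ℕ→ℚ n ·ₚ P n -ₚ deriv (P n) -ₚ bracket (suc n)) i
    coeffs i = begin-equality
      y                                                ≡⟨ rearrange (ℕ→ℚ n * coeff (P n) i) y d ⟩
      ℕ→ℚ n * coeff (P n) i - d - (ℕ→ℚ n * coeff (P n) i - y - d)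
        ≡⟨ cong₂ (λ u v → u - d - v) (coeff-· (ℕ→ℚ n) (P n) i) (coeff-bracket n i) ⟨
      coeff (ℕ→ℚ n ·ₚ P n) i - d - coeff (bracket (suc n)) i
        ≡⟨ cong (_- coeff (bracket (suc n)) i) (coeff-- (ℕ→ℚ n ·ₚ P n) (deriv (P n)) i) ⟨
      coeff (ℕ→ℚ n ·ₚ P n -ₚ deriv (P n)) i - coeff (bracket (suc n)) i
        ≡⟨ coeff-- (ℕ→ℚ n ·ₚ P n -ₚ deriv (P n)) (bracket (suc n)) i ⟨
      coeff (ℕ→ℚ n ·ₚ P n -ₚ deriv (P n) -ₚ bracket (suc n)) i ∎
      where
      y d : ℚ
      y = coeff (P (suc n)) i
      d = coeff (deriv (P n)) i

  -- Numerical bounds and the joint induction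

  -- For a, b ≥ 1 this reads a! b! ≤ (a + b - 1)!, one index better than the bound from binomial
  -- coefficients. Raising i by one multiplies the sides by i + 2 and i + l + 2.
  [1+i]!*[1+l]!≤[1+i+l]! : ∀ i l → suc i ! ℕ.* suc l ! ℕ.≤ suc (i ℕ.+ l) !
  [1+i]!*[1+l]!≤[1+i+l]! zero    l = ℕₚ.≤-reflexive (ℕₚ.*-identityˡ (suc l !))
  [1+i]!*[1+l]!≤[1+i+l]! (suc i) l = begin
    (suc (suc i) ℕ.* suc i !) ℕ.* suc l !          ≡⟨ ℕₚ.*-assoc (suc (suc i)) (suc i !) (suc l !) ⟩
    suc (suc i) ℕ.* (suc i ! ℕ.* suc l !)          ≤⟨ ℕₚ.*-mono-≤ (s≤s (s≤s (ℕₚ.m≤m+n i l))) ([1+i]!*[1+l]!≤[1+i+l]! i l) ⟩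
    suc (suc (i ℕ.+ l)) ℕ.* suc (i ℕ.+ l) !        ∎
    where open ℕₚ.≤-Reasoning

  -- The constant 3 is attained at 0: `⟦ P 0 ⟧` equals 3.
  P-bound : ℕ → ℕ
  P-bound n = 3 ℕ.* (n ! ℕ.* 2 ℕ.^ n)

  -- Chosen as the exact remainder. Since ‖Pₙ‖ ≤ (3/2)(n-1)‖Pₙ₋₁‖ + ‖Bₙ‖, the bound for Pₙ₋₁ uses up
  -- (9/4)(n-1)/n of the available 3, in units of n! 2ⁿ; what is left for ‖Bₙ‖ is 3(n+3)/(4n).
  bracket-bound : ℕ → ℕ
  bracket-bound n = 3 ℕ.* (n ℕ.+ 3) ℕ.* (n ! ℕ.* 2 ℕ.^ n)

  -- At index n = 2 + t the summands k ≤ t satisfy k! (n - 1 - k)! ≤ t!, while k = t + 1 yields (t + 1)!.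
  convolution-bound : ℕ → ℕ
  convolution-bound t = t ℕ.* (9 ℕ.* (t ℕ.+ 4) ℕ.* t ! ℕ.* 2 ℕ.^ suc t)
    ℕ.+ 9 ℕ.* (t ℕ.+ 4) ℕ.* suc t ! ℕ.* 2 ℕ.^ suc t

  record Bounds (n : ℕ) : Set where
    field
      ‖P‖≤       : ⟦ P n ⟧ ≤ ℕ→ℚ (P-bound n)
      ‖bracket‖≤ : ℕ→ℚ (4 ℕ.* n) * ⟦ bracket n ⟧ ≤ ℕ→ℚ (bracket-bound n)

  -- The weight `k` of the summand joins the 4 to form the factor `4 * k` under which `‖bracket‖≤`
  -- is stated, so no division occurs.
  summand-bound : ∀ k j → Bounds k → Bounds j →
    ℕ→ℚ 4 * ⟦ ℕ→ℚ k ·ₚ (bracket k *ₚ P j) ⟧ ≤ ℕ→ℚ (9 ℕ.* (k ℕ.+ 3) ℕ.* (k ! ℕ.* j !) ℕ.* 2 ℕ.^ (k ℕ.+ j))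
  summand-bound k j Bk Bj = begin
    ℕ→ℚ 4 * ⟦ ℕ→ℚ k ·ₚ (bracket k *ₚ P j) ⟧       ≡⟨ cong (ℕ→ℚ 4 *_) (‖n·p‖≡n‖p‖ k (bracket k *ₚ P j)) ⟩
    ℕ→ℚ 4 * (ℕ→ℚ k * ⟦ bracket k *ₚ P j ⟧)        ≤⟨ ℕ→ℚ-*-monoʳ-≤ 4 (ℕ→ℚ-*-monoʳ-≤ k (‖p*q‖≤‖p‖*‖q‖ (bracket k) (P j))) ⟩
    ℕ→ℚ 4 * (ℕ→ℚ k * (⟦ bracket k ⟧ * ⟦ P j ⟧))   ≡⟨ reassoc (ℕ→ℚ 4) (ℕ→ℚ k) ⟦ bracket k ⟧ ⟦ P j ⟧ ⟩
    ((ℕ→ℚ 4 * ℕ→ℚ k) * ⟦ bracket k ⟧) * ⟦ P j ⟧   ≡⟨ cong (λ c → (c * ⟦ bracket k ⟧) * ⟦ P j ⟧) (ℕ→ℚ-* 4 k) ⟨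
    (ℕ→ℚ (4 ℕ.* k) * ⟦ bracket k ⟧) * ⟦ P j ⟧     ≤⟨ *-mono-≤-nonNeg (0≤ℕ→ℚ (bracket-bound k)) 0≤⟦ P j ⟧
                                                      (Bounds.‖bracket‖≤ Bk) (Bounds.‖P‖≤ Bj) ⟩
    ℕ→ℚ (bracket-bound k) * ℕ→ℚ (P-bound j)       ≡⟨ ℕ→ℚ-* (bracket-bound k) (P-bound j) ⟨
    ℕ→ℚ (bracket-bound k ℕ.* P-bound j)           ≡⟨ cong ℕ→ℚ product ⟩
    ℕ→ℚ (9 ℕ.* (k ℕ.+ 3) ℕ.* (k ! ℕ.* j !) ℕ.* 2 ℕ.^ (k ℕ.+ j)) ∎
    where
    open ≤-Reasoning
    reassoc : ∀ a b c d → a * (b * (c * d)) ≡ ((a * b) * c) * d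
    reassoc = solve 4 (λ a b c d → a :* (b :* (c :* d)) := ((a :* b) :* c) :* d) refl
    regroup : ∀ l f x g y → (3 ℕ.* l ℕ.* (f ℕ.* x)) ℕ.* (3 ℕ.* (g ℕ.* y)) ≡ 9 ℕ.* l ℕ.* (f ℕ.* g) ℕ.* (x ℕ.* y)
    regroup = solveℕ 5 (λ l f x g y →
      (conℕ 3 ⊗ l ⊗ (f ⊗ x)) ⊗ (conℕ 3 ⊗ (g ⊗ y)) ≔
      conℕ 9 ⊗ l ⊗ (f ⊗ g) ⊗ (x ⊗ y)) refl
    product : bracket-bound k ℕ.* P-bound j ≡ 9 ℕ.* (k ℕ.+ 3) ℕ.* (k ! ℕ.* j !) ℕ.* 2 ℕ.^ (k ℕ.+ j)
    product = trans (regroup (k ℕ.+ 3) (k !) (2 ℕ.^ k) (j !) (2 ℕ.^ j))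
      (cong (9 ℕ.* (k ℕ.+ 3) ℕ.* (k ! ℕ.* j !) ℕ.*_) (sym (ℕₚ.^-distribˡ-+-* 2 k j)))

  -- The summand k = t + 1 must be split off: using its factorial (t+1)! for all t + 1 summands
  -- would give a total too large for `bracket-arith` at every t ≥ 1.
  ‖convolution‖≤ : ∀ t → (∀ {m} → m ℕ.< 2 ℕ.+ t → Bounds m) →
    ℕ→ℚ 4 * ⟦ convolution (2 ℕ.+ t) ⟧ ≤
    ℕ→ℚ (convolution-bound t)
  ‖convolution‖≤ t rec = begin
    ℕ→ℚ 4 * ⟦ convolution (2 ℕ.+ t) ⟧
      ≤⟨ ℕ→ℚ-*-monoʳ-≤ 4 (‖p+q‖≤‖p‖+‖q‖ (sum₁ t summand) (summand (suc t))) ⟩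
    ℕ→ℚ 4 * (⟦ sum₁ t summand ⟧ + ⟦ summand (suc t) ⟧)
      ≡⟨ *-distribˡ-+ (ℕ→ℚ 4) ⟦ sum₁ t summand ⟧ ⟦ summand (suc t) ⟧ ⟩
    ℕ→ℚ 4 * ⟦ sum₁ t summand ⟧ + ℕ→ℚ 4 * ⟦ summand (suc t) ⟧
      ≤⟨ +-mono-≤ (‖sum₁‖≤ 4 Y t summand initial) last ⟩
    ℕ→ℚ (t ℕ.* Y) + ℕ→ℚ Z
      ≡⟨ ℕ→ℚ-+ (t ℕ.* Y) Z ⟨
    ℕ→ℚ (t ℕ.* Y ℕ.+ Z) ∎
    where
    open ≤-Reasoning
    summand : ℕ → Poly
    summand k = ℕ→ℚ k ·ₚ (bracket k *ₚ P (2 ℕ.+ t ∸ k ∸ 1))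
    Y Z : ℕ
    Y = 9 ℕ.* (t ℕ.+ 4) ℕ.* t ! ℕ.* 2 ℕ.^ suc t
    Z = 9 ℕ.* (t ℕ.+ 4) ℕ.* suc t ! ℕ.* 2 ℕ.^ suc t
    bound : ∀ i → i ℕ.≤ t → ℕ→ℚ 4 * ⟦ summand (suc i) ⟧ ≤
      ℕ→ℚ (9 ℕ.* (suc i ℕ.+ 3) ℕ.* (suc i ! ℕ.* (t ∸ i) !) ℕ.* 2 ℕ.^ suc t)
    bound i i≤t = subst₂ (λ j m → ℕ→ℚ 4 * ⟦ ℕ→ℚ (suc i) ·ₚ (bracket (suc i) *ₚ P j) ⟧ ≤
        ℕ→ℚ (9 ℕ.* (suc i ℕ.+ 3) ℕ.* (suc i ! ℕ.* (t ∸ i) !) ℕ.* 2 ℕ.^ suc m))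
      (sym (complement t i i≤t)) (ℕₚ.m+[n∸m]≡n i≤t)
      (summand-bound (suc i) (t ∸ i) (rec (s≤s (s≤s i≤t)))
        (rec (s≤s (ℕₚ.≤-trans (ℕₚ.m∸n≤m t i) (ℕₚ.n≤1+n t)))))
    initial : ∀ k → 1 ℕ.≤ k → k ℕ.≤ t → ℕ→ℚ 4 * ⟦ summand k ⟧ ≤ ℕ→ℚ Y
    initial (suc i) _ i<t = ≤-trans (bound i (ℕₚ.<⇒≤ i<t)) (ℕ→ℚ-mono-≤
      (ℕₚ.*-monoˡ-≤ (2 ℕ.^ suc t) (ℕₚ.*-mono-≤ (ℕₚ.*-monoʳ-≤ 9 i+4≤t+4) factorials)))
      where
      -- One unit is given away here, so that `Y` and `Z` share the factor t + 4 which the last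
      -- summand requires.
      i+4≤t+4 : suc i ℕ.+ 3 ℕ.≤ t ℕ.+ 4
      i+4≤t+4 = ℕₚ.+-mono-≤ i<t (ℕₚ.n≤1+n 3)
      factorials : suc i ! ℕ.* (t ∸ i) ! ℕ.≤ t !
      factorials = subst₂ (λ j m → suc i ! ℕ.* j ! ℕ.≤ m !)
        (sym (ℕₚ.+-∸-assoc 1 i<t)) (ℕₚ.m+[n∸m]≡n i<t) ([1+i]!*[1+l]!≤[1+i+l]! i (t ∸ suc i))
    last : ℕ→ℚ 4 * ⟦ summand (suc t) ⟧ ≤ ℕ→ℚ Z
    last = subst (λ z → ℕ→ℚ 4 * ⟦ summand (suc t) ⟧ ≤ ℕ→ℚ z)
      (cong (ℕ._* 2 ℕ.^ suc t) (cong₂ (λ a b → 9 ℕ.* a ℕ.* b)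
        (sym (ℕₚ.+-suc t 3))
        (trans (cong (λ j → suc t ! ℕ.* j !) (ℕₚ.n∸n≡0 t)) (ℕₚ.*-identityʳ (suc t !)))))
      (bound t ℕₚ.≤-refl)

  -- In units of t! 2ᵗ⁺¹ the right side exceeds the left by 6t³ + 18t² - 15t. This vanishes at t =
  -- 0, where both sides are 120; substituting t = 1 + u makes all coefficients positive, so the
  -- excess can be added explicitly over ℕ.
  bracket-arith : ∀ t → 4 ℕ.* (2 ℕ.+ t) ℕ.* P-bound (suc t) ℕ.+ convolution-bound t
    ℕ.≤ bracket-bound (2 ℕ.+ t)
  bracket-arith zero    = ℕₚ.≤-refl
  bracket-arith (suc u) = ℕₚ.≤-trans (ℕₚ.m≤m+n _ _) (ℕₚ.≤-reflexive (expand u (suc u !) (2 ℕ.^ suc (suc u))))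
    where
    expand : ∀ u f e →
      (4 ℕ.* (3 ℕ.+ u) ℕ.* (3 ℕ.* ((2 ℕ.+ u) ℕ.* f ℕ.* e)) ℕ.+
        ((1 ℕ.+ u) ℕ.* (9 ℕ.* ((1 ℕ.+ u) ℕ.+ 4) ℕ.* f ℕ.* e) ℕ.+
         9 ℕ.* ((1 ℕ.+ u) ℕ.+ 4) ℕ.* ((2 ℕ.+ u) ℕ.* f) ℕ.* e)) ℕ.+
      3 ℕ.* (f ℕ.* e) ℕ.* (3 ℕ.+ 13 ℕ.* u ℕ.+ 12 ℕ.* (u ℕ.* u) ℕ.+ 2 ℕ.* (u ℕ.* u ℕ.* u))
      ≡ 3 ℕ.* ((3 ℕ.+ u) ℕ.+ 3) ℕ.* ((3 ℕ.+ u) ℕ.* ((2 ℕ.+ u) ℕ.* f) ℕ.* (2 ℕ.* e))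
    expand = solveℕ 3 (λ u f e →
      (conℕ 4 ⊗ (conℕ 3 ⊕ u) ⊗ (conℕ 3 ⊗ ((conℕ 2 ⊕ u) ⊗ f ⊗ e)) ⊕
        ((conℕ 1 ⊕ u) ⊗ (conℕ 9 ⊗ ((conℕ 1 ⊕ u) ⊕ conℕ 4) ⊗ f ⊗ e) ⊕
         conℕ 9 ⊗ ((conℕ 1 ⊕ u) ⊕ conℕ 4) ⊗ ((conℕ 2 ⊕ u) ⊗ f) ⊗ e)) ⊕
      conℕ 3 ⊗ (f ⊗ e) ⊗ (conℕ 3 ⊕ conℕ 13 ⊗ u ⊕ conℕ 12 ⊗ (u ⊗ u) ⊕ conℕ 2 ⊗ (u ⊗ u ⊗ u))
      ≔ conℕ 3 ⊗ ((conℕ 3 ⊕ u) ⊕ conℕ 3) ⊗ ((conℕ 3 ⊕ u) ⊗ ((conℕ 2 ⊕ u) ⊗ f) ⊗ (conℕ 2 ⊗ e))) refl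

  -- With n = 2 + t, the factor 6n(n-1) collects 4n(n-1) from (n-1) Pₙ₋₁ and 2n(n-1) from its
  -- derivative. Equality reflects the choice of `bracket-bound`.
  P-arith : ∀ t → 6 ℕ.* (2 ℕ.+ t) ℕ.* suc t ℕ.* P-bound (suc t) ℕ.+ bracket-bound (2 ℕ.+ t)
    ≡ 4 ℕ.* (2 ℕ.+ t) ℕ.* P-bound (2 ℕ.+ t)
  P-arith t = expand t (suc t !) (2 ℕ.^ suc t)
    where
    expand : ∀ t f e →
      6 ℕ.* (2 ℕ.+ t) ℕ.* (1 ℕ.+ t) ℕ.* (3 ℕ.* (f ℕ.* e)) ℕ.+
      3 ℕ.* ((2 ℕ.+ t) ℕ.+ 3) ℕ.* ((2 ℕ.+ t) ℕ.* f ℕ.* (2 ℕ.* e))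
      ≡ 4 ℕ.* (2 ℕ.+ t) ℕ.* (3 ℕ.* ((2 ℕ.+ t) ℕ.* f ℕ.* (2 ℕ.* e)))
    expand = solveℕ 3 (λ t f e →
      conℕ 6 ⊗ (conℕ 2 ⊕ t) ⊗ (conℕ 1 ⊕ t) ⊗ (conℕ 3 ⊗ (f ⊗ e)) ⊕
      conℕ 3 ⊗ ((conℕ 2 ⊕ t) ⊕ conℕ 3) ⊗ ((conℕ 2 ⊕ t) ⊗ f ⊗ (conℕ 2 ⊗ e))
      ≔ conℕ 4 ⊗ (conℕ 2 ⊕ t) ⊗ (conℕ 3 ⊗ ((conℕ 2 ⊕ t) ⊗ f ⊗ (conℕ 2 ⊗ e)))) refl

  bounds : ∀ n → Bounds n
  bounds = <-rec Bounds step
    where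
    open ≤-Reasoning
    step : ∀ n → (∀ {m} → m ℕ.< n → Bounds m) → Bounds n
    step zero          rec = record
      { ‖P‖≤       = toWitness {a? = ⟦ P 0 ⟧ ≤? ℕ→ℚ (P-bound 0)} _
      -- The left side is 0 because of the factor 4 · 0, whatever the truncated `0 ∸ 1` puts into
      -- `bracket 0`.
      ; ‖bracket‖≤ = toWitness {a? = ℕ→ℚ 0 * ⟦ bracket 0 ⟧ ≤? ℕ→ℚ (bracket-bound 0)} _
      }
    step (suc zero)    rec = record
      -- Here P₁ = y - 2 and B₁ = 1 - y, so the two inequalities are 4 ≤ 6 and 12 ≤ 24, settled by
      -- evaluation.
      { ‖P‖≤       = toWitness {a? = ⟦ P 1 ⟧ ≤? ℕ→ℚ (P-bound 1)} _
      ; ‖bracket‖≤ = toWitness {a? = ℕ→ℚ 4 * ⟦ bracket 1 ⟧ ≤? ℕ→ℚ (bracket-bound 1)} _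
      }
    step (suc (suc t)) rec = record
      { ‖P‖≤       = *-cancelˡ-≤-pos (ℕ→ℚ (4 ℕ.* n)) {{normalize-pos (4 ℕ.* n) 1}} P-step
      ; ‖bracket‖≤ = bracket-step
      }
      where
      n : ℕ
      n = 2 ℕ.+ t
      a d b s : ℚ
      a = ⟦ P (suc t) ⟧
      d = ⟦ deriv (P (suc t)) ⟧
      b = ⟦ bracket n ⟧
      s = ⟦ convolution n ⟧
      a≤ : a ≤ ℕ→ℚ (P-bound (suc t))
      a≤ = Bounds.‖P‖≤ (rec ℕₚ.≤-refl)
      bracket-step : ℕ→ℚ (4 ℕ.* n) * b ≤ ℕ→ℚ (bracket-bound n)
      bracket-step = begin
        ℕ→ℚ (4 ℕ.* n) * b                                                  ≡⟨ cong (_* b) (ℕ→ℚ-* 4 n) ⟩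
        ℕ→ℚ 4 * ℕ→ℚ n * b                                                  ≡⟨ *-assoc (ℕ→ℚ 4) (ℕ→ℚ n) b ⟩
        ℕ→ℚ 4 * (ℕ→ℚ n * b)                                                ≤⟨ ℕ→ℚ-*-monoʳ-≤ 4 (n‖bracket‖≤ (suc t)) ⟩
        ℕ→ℚ 4 * (ℕ→ℚ n * a + s)                                            ≡⟨ distrib (ℕ→ℚ 4) (ℕ→ℚ n) a s ⟩
        ℕ→ℚ 4 * ℕ→ℚ n * a + ℕ→ℚ 4 * s                                      ≡⟨ cong (λ c → c * a + ℕ→ℚ 4 * s) (ℕ→ℚ-* 4 n) ⟨
        ℕ→ℚ (4 ℕ.* n) * a + ℕ→ℚ 4 * s                                      ≤⟨ +-mono-≤ (ℕ→ℚ-*-monoʳ-≤ (4 ℕ.* n) a≤) (‖convolution‖≤ t rec) ⟩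
        ℕ→ℚ (4 ℕ.* n) * ℕ→ℚ (P-bound (suc t)) + ℕ→ℚ (convolution-bound t)  ≡⟨ cong (_+ ℕ→ℚ (convolution-bound t)) (ℕ→ℚ-* (4 ℕ.* n) (P-bound (suc t))) ⟨
        ℕ→ℚ (4 ℕ.* n ℕ.* P-bound (suc t)) + ℕ→ℚ (convolution-bound t)      ≡⟨ ℕ→ℚ-+ (4 ℕ.* n ℕ.* P-bound (suc t)) (convolution-bound t) ⟨
        ℕ→ℚ (4 ℕ.* n ℕ.* P-bound (suc t) ℕ.+ convolution-bound t)          ≤⟨ ℕ→ℚ-mono-≤ (bracket-arith t) ⟩
        ℕ→ℚ (bracket-bound n)                                              ∎
        where
        distrib : ∀ c m a s → c * (m * a + s) ≡ c * m * a + c * s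
        distrib = solve 4 (λ c m a s → c :* (m :* a :+ s) := c :* m :* a :+ c :* s) refl
      -- Splitting 4n as 2n · 2 supplies the 2 of the derivative estimate; the index `suc t` is at
      -- least 1, so `length-P` gives degree at most `suc t`.
      d≤ : ℕ→ℚ (4 ℕ.* n) * d ≤ ℕ→ℚ (2 ℕ.* n) * (ℕ→ℚ (suc t) * a)
      d≤ = begin
        ℕ→ℚ (4 ℕ.* n) * d               ≡⟨ cong (λ m → ℕ→ℚ m * d) (double n) ⟩
        ℕ→ℚ (2 ℕ.* n ℕ.* 2) * d         ≡⟨ cong (_* d) (ℕ→ℚ-* (2 ℕ.* n) 2) ⟩
        ℕ→ℚ (2 ℕ.* n) * ℕ→ℚ 2 * d       ≡⟨ *-assoc (ℕ→ℚ (2 ℕ.* n)) (ℕ→ℚ 2) d ⟩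
        ℕ→ℚ (2 ℕ.* n) * (ℕ→ℚ 2 * d)     ≤⟨ ℕ→ℚ-*-monoʳ-≤ (2 ℕ.* n) (2‖deriv‖≤d‖p‖ (suc t) (P (suc t)) (length-P (suc t))) ⟩
        ℕ→ℚ (2 ℕ.* n) * (ℕ→ℚ (suc t) * a) ∎
        where
        double : ∀ n → 4 ℕ.* n ≡ 2 ℕ.* n ℕ.* 2
        double = solveℕ 1 (λ n → conℕ 4 ⊗ n ≔ conℕ 2 ⊗ n ⊗ conℕ 2) refl
      P-step : ℕ→ℚ (4 ℕ.* n) * ⟦ P n ⟧ ≤ ℕ→ℚ (4 ℕ.* n) * ℕ→ℚ (P-bound n)
      P-step = begin
        ℕ→ℚ (4 ℕ.* n) * ⟦ P n ⟧
          ≤⟨ ℕ→ℚ-*-monoʳ-≤ (4 ℕ.* n) (‖P[1+n]‖≤ (suc t)) ⟩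
        ℕ→ℚ (4 ℕ.* n) * (ℕ→ℚ (suc t) * a + d + b)
          ≡⟨ distrib (ℕ→ℚ (4 ℕ.* n)) (ℕ→ℚ (suc t) * a) d b ⟩
        ℕ→ℚ (4 ℕ.* n) * (ℕ→ℚ (suc t) * a) + ℕ→ℚ (4 ℕ.* n) * d + ℕ→ℚ (4 ℕ.* n) * b
          ≤⟨ +-mono-≤ (+-monoʳ-≤ (ℕ→ℚ (4 ℕ.* n) * (ℕ→ℚ (suc t) * a)) d≤) bracket-step ⟩
        ℕ→ℚ (4 ℕ.* n) * (ℕ→ℚ (suc t) * a) + ℕ→ℚ (2 ℕ.* n) * (ℕ→ℚ (suc t) * a) + ℕ→ℚ (bracket-bound n)
          ≡⟨ cong (_+ ℕ→ℚ (bracket-bound n)) collect ⟩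
        ℕ→ℚ (6 ℕ.* n ℕ.* suc t) * a + ℕ→ℚ (bracket-bound n)
          ≤⟨ +-monoˡ-≤ (ℕ→ℚ (bracket-bound n)) (ℕ→ℚ-*-monoʳ-≤ (6 ℕ.* n ℕ.* suc t) a≤) ⟩
        ℕ→ℚ (6 ℕ.* n ℕ.* suc t) * ℕ→ℚ (P-bound (suc t)) + ℕ→ℚ (bracket-bound n)
          ≡⟨ cong (_+ ℕ→ℚ (bracket-bound n)) (ℕ→ℚ-* (6 ℕ.* n ℕ.* suc t) (P-bound (suc t))) ⟨
        ℕ→ℚ (6 ℕ.* n ℕ.* suc t ℕ.* P-bound (suc t)) + ℕ→ℚ (bracket-bound n)
          ≡⟨ ℕ→ℚ-+ (6 ℕ.* n ℕ.* suc t ℕ.* P-bound (suc t)) (bracket-bound n) ⟨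
        ℕ→ℚ (6 ℕ.* n ℕ.* suc t ℕ.* P-bound (suc t) ℕ.+ bracket-bound n)
          ≡⟨ cong ℕ→ℚ (P-arith t) ⟩
        ℕ→ℚ (4 ℕ.* n ℕ.* P-bound n)
          ≡⟨ ℕ→ℚ-* (4 ℕ.* n) (P-bound n) ⟩
        ℕ→ℚ (4 ℕ.* n) * ℕ→ℚ (P-bound n) ∎
        where
        distrib : ∀ c x y z → c * (x + y + z) ≡ c * x + c * y + c * z
        distrib = solve 4 (λ c x y z → c :* (x :+ y :+ z) := c :* x :+ c :* y :+ c :* z) refl
        six : ∀ n → 4 ℕ.* n ℕ.+ 2 ℕ.* n ≡ 6 ℕ.* n
        six n = sym (ℕₚ.*-distribʳ-+ n 4 2)
        collect : ℕ→ℚ (4 ℕ.* n) * (ℕ→ℚ (suc t) * a) + ℕ→ℚ (2 ℕ.* n) * (ℕ→ℚ (suc t) * a)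
          ≡ ℕ→ℚ (6 ℕ.* n ℕ.* suc t) * a
        collect = begin-equality
          ℕ→ℚ (4 ℕ.* n) * (ℕ→ℚ (suc t) * a) + ℕ→ℚ (2 ℕ.* n) * (ℕ→ℚ (suc t) * a)
            ≡⟨ *-distribʳ-+ (ℕ→ℚ (suc t) * a) (ℕ→ℚ (4 ℕ.* n)) (ℕ→ℚ (2 ℕ.* n)) ⟨
          (ℕ→ℚ (4 ℕ.* n) + ℕ→ℚ (2 ℕ.* n)) * (ℕ→ℚ (suc t) * a)
            ≡⟨ cong (_* (ℕ→ℚ (suc t) * a)) (trans (sym (ℕ→ℚ-+ (4 ℕ.* n) (2 ℕ.* n))) (cong ℕ→ℚ (six n))) ⟩
          ℕ→ℚ (6 ℕ.* n) * (ℕ→ℚ (suc t) * a)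
            ≡⟨ *-assoc (ℕ→ℚ (6 ℕ.* n)) (ℕ→ℚ (suc t)) a ⟨
          ℕ→ℚ (6 ℕ.* n) * ℕ→ℚ (suc t) * a
            ≡⟨ cong (_* a) (ℕ→ℚ-* (6 ℕ.* n) (suc t)) ⟨
          ℕ→ℚ (6 ℕ.* n ℕ.* suc t) * a ∎

  -- Estimates at rational points q ≥ 2

  infixr 8 _^ℚ_

  _^ℚ_ : ℚ → ℕ → ℚ
  q ^ℚ zero  = 1ℚ
  q ^ℚ suc n = q * q ^ℚ n

  evalℚ : Poly → ℚ → ℚ
  evalℚ []      q = 0ℚ
  evalℚ (a ∷ p) q = a + q * evalℚ p q

  0≤q^n : ∀ {q} n → 0ℚ ≤ q → 0ℚ ≤ q ^ℚ n
  0≤q^n zero    0≤q = nonNegative⁻¹ 1ℚ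
  0≤q^n (suc n) 0≤q = 0≤* 0≤q (0≤q^n n 0≤q)

  2^n≤q^n : ∀ {q} n → ℕ→ℚ 2 ≤ q → ℕ→ℚ (2 ℕ.^ n) ≤ q ^ℚ n
  2^n≤q^n     zero    2≤q = ≤-refl
  2^n≤q^n {q} (suc n) 2≤q = begin
    ℕ→ℚ (2 ℕ.* 2 ℕ.^ n)          ≡⟨ ℕ→ℚ-* 2 (2 ℕ.^ n) ⟩
    ℕ→ℚ 2 * ℕ→ℚ (2 ℕ.^ n)        ≤⟨ *-mono-≤-nonNeg (≤-trans (0≤ℕ→ℚ 2) 2≤q) (0≤ℕ→ℚ (2 ℕ.^ n)) 2≤q (2^n≤q^n n 2≤q) ⟩
    q * q ^ℚ n                   ∎
    where open ≤-Reasoning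

  -- For each monomial 2ⁿ qᵏ ≤ qⁿ 2ᵏ, because (q/2)ⁿ⁻ᵏ ≥ 1 when k ≤ n; the induction sums these
  -- along Horner's scheme.
  2^n∣p[q]∣≤q^n‖p‖ : ∀ n p {q} → ℕ→ℚ 2 ≤ q → length p ℕ.≤ suc n →
    ℕ→ℚ (2 ℕ.^ n) * ∣ evalℚ p q ∣ ≤ q ^ℚ n * ⟦ p ⟧
  2^n∣p[q]∣≤q^n‖p‖ n [] {q} 2≤q h =
    ≤-reflexive (trans (*-zeroʳ (ℕ→ℚ (2 ℕ.^ n))) (sym (*-zeroʳ (q ^ℚ n))))
  2^n∣p[q]∣≤q^n‖p‖ zero (a ∷ []) {q} 2≤q h =
    *-monoˡ-≤-nonNeg 1ℚ (≤-reflexive (trans (cong ∣_∣ (trans (cong (a +_) (*-zeroʳ q)) (+-identityʳ a)))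
      (sym (+-identityʳ ∣ a ∣))))
  2^n∣p[q]∣≤q^n‖p‖ zero (a ∷ b ∷ p) 2≤q (s≤s ())
  2^n∣p[q]∣≤q^n‖p‖ (suc n) (a ∷ p) {q} 2≤q (s≤s h) = begin
    ℕ→ℚ (2 ℕ.* 2 ℕ.^ n) * ∣ a + q * v ∣
      ≤⟨ ℕ→ℚ-*-monoʳ-≤ (2 ℕ.* 2 ℕ.^ n) (∣p+q∣≤∣p∣+∣q∣ a (q * v)) ⟩
    ℕ→ℚ (2 ℕ.* 2 ℕ.^ n) * (∣ a ∣ + ∣ q * v ∣)
      ≡⟨ cong (λ x → ℕ→ℚ (2 ℕ.* 2 ℕ.^ n) * (∣ a ∣ + x)) (trans (∣p*q∣≡∣p∣*∣q∣ q v) (cong (_* ∣ v ∣) (0≤p⇒∣p∣≡p 0≤q))) ⟩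
    ℕ→ℚ (2 ℕ.* 2 ℕ.^ n) * (∣ a ∣ + q * ∣ v ∣)
      ≡⟨ *-distribˡ-+ (ℕ→ℚ (2 ℕ.* 2 ℕ.^ n)) ∣ a ∣ (q * ∣ v ∣) ⟩
    ℕ→ℚ (2 ℕ.* 2 ℕ.^ n) * ∣ a ∣ + ℕ→ℚ (2 ℕ.* 2 ℕ.^ n) * (q * ∣ v ∣)
      ≡⟨ cong (λ x → ℕ→ℚ (2 ℕ.* 2 ℕ.^ n) * ∣ a ∣ + x * (q * ∣ v ∣)) (ℕ→ℚ-* 2 (2 ℕ.^ n)) ⟩
    ℕ→ℚ (2 ℕ.* 2 ℕ.^ n) * ∣ a ∣ + (ℕ→ℚ 2 * ℕ→ℚ (2 ℕ.^ n)) * (q * ∣ v ∣)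
      ≡⟨ cong (ℕ→ℚ (2 ℕ.* 2 ℕ.^ n) * ∣ a ∣ +_) (regroup (ℕ→ℚ 2) (ℕ→ℚ (2 ℕ.^ n)) q ∣ v ∣) ⟩
    ℕ→ℚ (2 ℕ.* 2 ℕ.^ n) * ∣ a ∣ + ℕ→ℚ 2 * (q * (ℕ→ℚ (2 ℕ.^ n) * ∣ v ∣))
      ≤⟨ +-mono-≤ (*-monoʳ-≤-nonNeg ∣ a ∣ {{∣-∣-nonNeg a}} (2^n≤q^n (suc n) 2≤q))
           (ℕ→ℚ-*-monoʳ-≤ 2 (*-monoˡ-≤-nonNeg q {{nonNegative 0≤q}} (2^n∣p[q]∣≤q^n‖p‖ n p 2≤q h))) ⟩
    q * q ^ℚ n * ∣ a ∣ + ℕ→ℚ 2 * (q * (q ^ℚ n * ⟦ p ⟧))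
      ≡⟨ factor q (q ^ℚ n) ∣ a ∣ (ℕ→ℚ 2) ⟦ p ⟧ ⟩
    q * q ^ℚ n * (∣ a ∣ + ℕ→ℚ 2 * ⟦ p ⟧) ∎
    where
    open ≤-Reasoning
    v : ℚ
    v = evalℚ p q
    0≤q : 0ℚ ≤ q
    0≤q = ≤-trans (0≤ℕ→ℚ 2) 2≤q
    regroup : ∀ a b c d → (a * b) * (c * d) ≡ a * (c * (b * d))
    regroup = solve 4 (λ a b c d → (a :* b) :* (c :* d) := a :* (c :* (b :* d))) refl
    factor : ∀ q e a c x → q * e * a + c * (q * (e * x)) ≡ q * e * (a + c * x)
    factor = solve 5 (λ q e a c x → q :* e :* a :+ c :* (q :* (e :* x)) := q :* e :* (a :+ c :* x)) refl

  ∣P[q]∣≤ : ∀ n {q} → 1 ℕ.≤ n → ℕ→ℚ 2 ≤ q → ∣ evalℚ (P n) q ∣ ≤ ℕ→ℚ (3 ℕ.* n !) * q ^ℚ n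
  -- Exposing the successor lets `1 ⊔ n` reduce to `n`, so `length-P n` gives degree at most n.
  ∣P[q]∣≤ n@(suc _) {q} 1≤n 2≤q =
    *-cancelˡ-≤-pos (ℕ→ℚ (2 ℕ.^ n)) {{normalize-pos (2 ℕ.^ n) 1 {{_}} {{ℕₚ.m^n≢0 2 n}}}} (begin
      ℕ→ℚ (2 ℕ.^ n) * ∣ evalℚ (P n) q ∣               ≤⟨ 2^n∣p[q]∣≤q^n‖p‖ n (P n) 2≤q (length-P n) ⟩
      q ^ℚ n * ⟦ P n ⟧                                ≤⟨ *-monoˡ-≤-nonNeg (q ^ℚ n)
                                                           {{nonNegative (0≤q^n n (≤-trans (0≤ℕ→ℚ 2) 2≤q))}}
                                                           (Bounds.‖P‖≤ (bounds n)) ⟩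
      q ^ℚ n * ℕ→ℚ (3 ℕ.* (n ! ℕ.* 2 ℕ.^ n))          ≡⟨ cong (λ m → q ^ℚ n * ℕ→ℚ m) (ℕₚ.*-assoc 3 (n !) (2 ℕ.^ n)) ⟨
      q ^ℚ n * ℕ→ℚ (3 ℕ.* n ! ℕ.* 2 ℕ.^ n)            ≡⟨ cong (q ^ℚ n *_) (ℕ→ℚ-* (3 ℕ.* n !) (2 ℕ.^ n)) ⟩
      q ^ℚ n * (ℕ→ℚ (3 ℕ.* n !) * ℕ→ℚ (2 ℕ.^ n))      ≡⟨ rotate (q ^ℚ n) (ℕ→ℚ (3 ℕ.* n !)) (ℕ→ℚ (2 ℕ.^ n)) ⟩
      ℕ→ℚ (2 ℕ.^ n) * (ℕ→ℚ (3 ℕ.* n !) * q ^ℚ n)      ∎)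
    where
    open ≤-Reasoning
    rotate : ∀ a b c → a * (b * c) ≡ c * (b * a)
    rotate = solve 3 (λ a b c → a :* (b :* c) := c :* (b :* a)) refl

  ∣P₀[q]∣≤ : ∀ {q} → ℕ→ℚ 2 ≤ q → ∣ evalℚ (P 0) q ∣ ≤ q
  ∣P₀[q]∣≤ {q} 2≤q = begin
    ∣ - 1ℚ + q * (1ℚ + q * 0ℚ) ∣ ≡⟨ cong ∣_∣ (simplify q) ⟩
    ∣ - 1ℚ + q ∣                 ≡⟨ 0≤p⇒∣p∣≡p (+-monoʳ-≤ (- 1ℚ) (≤-trans (ℕ→ℚ-mono-≤ {1} {2} (s≤s z≤n)) 2≤q)) ⟩
    - 1ℚ + q                     ≤⟨ +-monoˡ-≤ q (nonPositive⁻¹ (- 1ℚ)) ⟩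
    0ℚ + q                       ≡⟨ +-identityˡ q ⟩
    q                            ∎
    where
    open ≤-Reasoning
    simplify : ∀ q → - 1ℚ + q * (1ℚ + q * 0ℚ) ≡ - 1ℚ + q
    simplify = solve 1 (λ q → con (- 1ℚ) :+ q :* (con 1ℚ :+ q :* con 0ℚ) := con (- 1ℚ) :+ q) refl

  -- Passage from rational points to reals

  -- A sequence representing a real y ≥ 2 may have terms slightly below 2; there the bounds
  -- are transported from the point 2.
  Lipschitz₂ : (ℚ → ℚ) → Set
  Lipschitz₂ f = ∃ λ L → 0ℚ ≤ L × (∀ q → 0ℚ ≤ q → q ≤ ℕ→ℚ 2 → ∣ f q - f (ℕ→ℚ 2) ∣ ≤ L * (ℕ→ℚ 2 - q))

  constant-Lipschitz : ∀ a → Lipschitz₂ (λ _ → a)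
  constant-Lipschitz a = 0ℚ , ≤-refl , λ q _ _ →
    ≤-reflexive (trans (cong ∣_∣ (+-inverseʳ a)) (sym (*-zeroˡ (ℕ→ℚ 2 - q))))

  -- Product rule for differences: q f(q) - 2 f(2) = q (f(q) - f(2)) - f(2) (2 - q), and q ≤ 2
  -- bounds the first factor. Polynomials and monomials are both built by this step.
  horner-Lipschitz : ∀ a {f} → Lipschitz₂ f → Lipschitz₂ (λ q → a + q * f q)
  horner-Lipschitz a {f} (L , 0≤L , h) =
    two * L + ∣ f two ∣ ,
    +-mono-≤ (ℕ→ℚ-*-monoʳ-≤ 2 0≤L) (0≤∣p∣ (f two)) ,
    λ q 0≤q q≤2 → begin
      ∣ (a + q * f q) - (a + two * f two) ∣           ≡⟨ cong ∣_∣ (split a q (f q) two (f two)) ⟩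
      ∣ q * (f q - f two) - f two * (two - q) ∣       ≤⟨ ∣p-q∣≤∣p∣+∣q∣ (q * (f q - f two)) (f two * (two - q)) ⟩
      ∣ q * (f q - f two) ∣ + ∣ f two * (two - q) ∣
        ≡⟨ cong₂ _+_
             (trans (∣p*q∣≡∣p∣*∣q∣ q (f q - f two)) (cong (_* ∣ f q - f two ∣) (0≤p⇒∣p∣≡p 0≤q)))
             (trans (∣p*q∣≡∣p∣*∣q∣ (f two) (two - q)) (cong (∣ f two ∣ *_) (0≤p⇒∣p∣≡p (0≤2-q q q≤2)))) ⟩
      q * ∣ f q - f two ∣ + ∣ f two ∣ * (two - q)
        ≤⟨ +-monoˡ-≤ (∣ f two ∣ * (two - q)) (*-mono-≤-nonNeg (0≤ℕ→ℚ 2) (0≤∣p∣ (f q - f two)) q≤2 (h q 0≤q q≤2)) ⟩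
      two * (L * (two - q)) + ∣ f two ∣ * (two - q)   ≡⟨ factor two L (two - q) ∣ f two ∣ ⟩
      (two * L + ∣ f two ∣) * (two - q)               ∎
    where
    open ≤-Reasoning
    two : ℚ
    two = ℕ→ℚ 2
    0≤2-q : ∀ q → q ≤ two → 0ℚ ≤ two - q
    0≤2-q q q≤2 = subst (_≤ two - q) (+-inverseʳ q) (+-monoˡ-≤ (- q) q≤2)
    split : ∀ a q x t y → (a + q * x) - (a + t * y) ≡ q * (x - y) - y * (t - q)
    split = solve 5 (λ a q x t y → (a :+ q :* x) :- (a :+ t :* y) := q :* (x :- y) :- y :* (t :- q)) refl
    factor : ∀ t L d y → t * (L * d) + y * d ≡ (t * L + y) * d
    factor = solve 4 (λ t L d y → t :* (L :* d) :+ y :* d := (t :* L :+ y) :* d) refl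

  Lipschitz₂-resp : ∀ {f g} → (∀ q → f q ≡ g q) → Lipschitz₂ f → Lipschitz₂ g
  Lipschitz₂-resp eq (L , 0≤L , h) = L , 0≤L , λ q 0≤q q≤2 →
    subst₂ (λ x y → ∣ x - y ∣ ≤ L * (ℕ→ℚ 2 - q)) (eq q) (eq (ℕ→ℚ 2)) (h q 0≤q q≤2)

  evalℚ-Lipschitz : ∀ p → Lipschitz₂ (evalℚ p)
  evalℚ-Lipschitz []      = constant-Lipschitz 0ℚ
  evalℚ-Lipschitz (a ∷ p) = horner-Lipschitz a (evalℚ-Lipschitz p)

  monomial-Lipschitz : ∀ c n → Lipschitz₂ (λ q → c * q ^ℚ n)
  monomial-Lipschitz c zero    = constant-Lipschitz (c * 1ℚ)
  monomial-Lipschitz c (suc n) = Lipschitz₂-resp (λ q → rearrange c q (q ^ℚ n))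
    (horner-Lipschitz 0ℚ (monomial-Lipschitz c n))
    where
    rearrange : ∀ c q x → 0ℚ + q * (c * x) ≡ c * (q * x)
    rearrange = solve 3 (λ c q x → con 0ℚ :+ q :* (c :* x) := c :* (q :* x)) refl

  -- For a term q < 2 the estimate goes through 2: |f(q)| ≤ |f(2)| + L(2-q) ≤ g(2) + L(2-q) ≤ g(q) +
  -- (L+M)(2-q), and 2 - q is eventually as small as desired.
  ≤ᴿ-from-≥2 : ∀ {f g} → Lipschitz₂ f → Lipschitz₂ g →
    (∀ {q} → ℕ→ℚ 2 ≤ q → ∣ f q ∣ ≤ g q) →
    ∀ y → ℕ→ℝ 2 ≤ᴿ y →
    ∀ ε → 0ℚ < ε → ∃ λ N → ∀ n → N ℕ.≤ n → ∣ f (seq y n) ∣ ≤ g (seq y n) + ε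
  ≤ᴿ-from-≥2 {f} {g} (L , 0≤L , hf) (M , 0≤M , hg) f≤g y 2≤y ε 0<ε =
    let N , 2≤y+δ = 2≤y δ 0<δ in N , λ n N≤n → near (seq y n) (2≤y+δ n N≤n)
    where
    open ≤-Reasoning
    two K : ℚ
    two = ℕ→ℚ 2
    -- The summand 1 makes K invertible even when L and M are both 0.
    K = 1ℚ + (L + M)
    0<K : 0ℚ < K
    0<K = +-mono-<-≤ (positive⁻¹ 1ℚ) (+-mono-≤ 0≤L 0≤M)
    instance
      K-pos : Positive K
      K-pos = positive 0<K
      K≢0 : NonZero K
      K≢0 = pos⇒nonZero K
      1/K-pos : Positive (1/ K)
      1/K-pos = 1/pos⇒pos K
    δ : ℚ
    -- The part ε/K absorbs the error (L+M)(2-q); the cap 1 keeps q ≥ 2 - δ ≥ 1, inside the interval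
    -- where the Lipschitz bounds hold.
    δ = 1ℚ ⊓ (1/ K * ε)
    0<ε/K : 0ℚ < 1/ K * ε
    0<ε/K = subst (_< 1/ K * ε) (*-zeroʳ (1/ K)) (*-monoʳ-<-pos (1/ K) 0<ε)
    0<δ : 0ℚ < δ
    0<δ with ⊓-sel 1ℚ (1/ K * ε)
    ... | inj₁ e = subst (0ℚ <_) (sym e) (positive⁻¹ 1ℚ)
    ... | inj₂ e = subst (0ℚ <_) (sym e) 0<ε/K
    Kδ≤ε : K * δ ≤ ε
    Kδ≤ε = begin
      K * δ             ≤⟨ *-monoˡ-≤-nonNeg K {{pos⇒nonNeg K}} (p⊓q≤q 1ℚ (1/ K * ε)) ⟩
      K * (1/ K * ε)    ≡⟨ *-assoc K (1/ K) ε ⟨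
      K * 1/ K * ε      ≡⟨ cong (_* ε) (*-inverseʳ K) ⟩
      1ℚ * ε            ≡⟨ *-identityˡ ε ⟩
      ε                 ∎
    p≤∣p∣ : ∀ p → p ≤ ∣ p ∣
    p≤∣p∣ p with ≤-total 0ℚ p
    ... | inj₁ 0≤p = ≤-reflexive (sym (0≤p⇒∣p∣≡p 0≤p))
    ... | inj₂ p≤0 = ≤-trans p≤0 (0≤∣p∣ p)
    split : ∀ a b → a ≡ b + (a - b)
    split = solve 2 (λ a b → a := b :+ (a :- b)) refl
    swap : ∀ a b → a ≡ b + - (b - a)
    swap = solve 2 (λ a b → a := b :+ :- (b :- a)) refl
    -- The padding by `0ℚ` gives L + M the shape of K, so that 0 ≤ 1 in the first summand suffices
    -- to compare them.
    collect : ∀ x L M d → x + M * d + L * d ≡ x + (0ℚ + (L + M)) * d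
    collect = solve 4 (λ x L M d → x :+ M :* d :+ L :* d := x :+ (con 0ℚ :+ (L :+ M)) :* d) refl
    near : ∀ q → two ≤ q + δ → ∣ f q ∣ ≤ g q + ε
    near q 2≤q+δ with ≤-total two q
    ... | inj₁ 2≤q = ≤-trans (f≤g 2≤q) (subst (_≤ g q + ε) (+-identityʳ (g q)) (+-monoʳ-≤ (g q) (<⇒≤ 0<ε)))
    ... | inj₂ q≤2 = begin
      ∣ f q ∣                                      ≡⟨ cong ∣_∣ (split (f q) (f two)) ⟩
      ∣ f two + (f q - f two) ∣                    ≤⟨ ∣p+q∣≤∣p∣+∣q∣ (f two) (f q - f two) ⟩
      ∣ f two ∣ + ∣ f q - f two ∣                  ≤⟨ +-mono-≤ (f≤g ≤-refl) (hf q 0≤q q≤2) ⟩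
      g two + L * (two - q)                        ≤⟨ +-monoˡ-≤ (L * (two - q)) g2≤ ⟩
      g q + M * (two - q) + L * (two - q)          ≡⟨ collect (g q) L M (two - q) ⟩
      g q + (0ℚ + (L + M)) * (two - q)             ≤⟨ +-monoʳ-≤ (g q) (≤-trans
                                                        (*-mono-≤-nonNeg (<⇒≤ 0<K) 0≤2-q
                                                          (+-monoˡ-≤ (L + M) (nonNegative⁻¹ 1ℚ)) 2-q≤δ) Kδ≤ε) ⟩
      g q + ε                                      ∎
      where
      0≤2-q : 0ℚ ≤ two - q
      0≤2-q = subst (_≤ two - q) (+-inverseʳ q) (+-monoˡ-≤ (- q) q≤2)
      cancel : ∀ a b → a + b - a ≡ b
      cancel = solve 2 (λ a b → a :+ b :- a := b) refl
      cancel′ : ∀ a b → a + b - b ≡ a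
      cancel′ = solve 2 (λ a b → a :+ b :- b := a) refl
      2-q≤δ : two - q ≤ δ
      2-q≤δ = subst (two - q ≤_) (cancel q δ) (+-monoˡ-≤ (- q) 2≤q+δ)
      0≤q : 0ℚ ≤ q
      0≤q = begin
        0ℚ             ≤⟨ nonNegative⁻¹ 1ℚ ⟩
        two - 1ℚ       ≤⟨ +-monoʳ-≤ two (neg-antimono-≤ (p⊓q≤p 1ℚ (1/ K * ε))) ⟩
        two - δ        ≤⟨ +-monoˡ-≤ (- δ) 2≤q+δ ⟩
        q + δ - δ      ≡⟨ cancel′ q δ ⟩
        q              ∎
      g2≤ : g two ≤ g q + M * (two - q)
      g2≤ = begin
        g two                          ≡⟨ swap (g two) (g q) ⟩
        g q + - (g q - g two)          ≤⟨ +-monoʳ-≤ (g q) (p≤∣p∣ (- (g q - g two))) ⟩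
        g q + ∣ - (g q - g two) ∣      ≡⟨ cong (g q +_) (∣-p∣≡∣p∣ (g q - g two)) ⟩
        g q + ∣ g q - g two ∣          ≤⟨ +-monoʳ-≤ (g q) (hg q 0≤q q≤2) ⟩
        g q + M * (two - q)            ∎

  seq-eval : ∀ p y i → seq (eval p y) i ≡ evalℚ p (seq y i)
  seq-eval []      y i = refl
  seq-eval (a ∷ p) y i = cong (λ x → a + seq y i * x) (seq-eval p y i)

  seq-^ᴿ : ∀ y n i → seq (y ^ᴿ n) i ≡ seq y i ^ℚ n
  seq-^ᴿ y zero    i = refl
  seq-^ᴿ y (suc n) i = cong (seq y i *_) (seq-^ᴿ y n i)

  P-estimate : ∀ y n → ℕ→ℝ 2 ≤ᴿ y → 1 ℕ.≤ n → ∣ eval (P n) y ∣ᴿ ≤ᴿ ℕ→ℝ (3 ℕ.* n !) *ᴿ y ^ᴿ n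
  P-estimate y n 2≤y 1≤n ε 0<ε =
    let N , h = ≤ᴿ-from-≥2 (evalℚ-Lipschitz (P n)) (monomial-Lipschitz (ℕ→ℚ (3 ℕ.* n !)) n)
                  (∣P[q]∣≤ n 1≤n) y 2≤y ε 0<ε
    in N , λ i N≤i → subst₂ (λ u v → ∣ u ∣ ≤ ℕ→ℚ (3 ℕ.* n !) * v + ε)
         (sym (seq-eval (P n) y i)) (sym (seq-^ᴿ y n i)) (h i N≤i)

  P₀-estimate : ∀ y → ℕ→ℝ 2 ≤ᴿ y → ∣ eval (P 0) y ∣ᴿ ≤ᴿ y
  P₀-estimate y 2≤y ε 0<ε =
    let N , h = ≤ᴿ-from-≥2 (evalℚ-Lipschitz (P 0)) identity-Lipschitz ∣P₀[q]∣≤ y 2≤y ε 0<ε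
    in N , λ i N≤i → subst (λ u → ∣ u ∣ ≤ seq y i + ε) (sym (seq-eval (P 0) y i)) (h i N≤i)
    where
    identity-Lipschitz : Lipschitz₂ (λ q → q)
    identity-Lipschitz = Lipschitz₂-resp (λ q → trans (+-identityˡ (q * 1ℚ)) (*-identityʳ q))
      (horner-Lipschitz 0ℚ (constant-Lipschitz 1ℚ))

open import Data.Nat.Base using (ℕ; _≤_; _*_; _!)
open import Data.Product.Base using (_×_; _,_)

theorem5p9 : (∀ (y : ℝ) (n : ℕ) → ℕ→ℝ 2 ≤ᴿ y → 1 ≤ n → ∣ eval (P n) y ∣ᴿ ≤ᴿ ℕ→ℝ (3 * n !) *ᴿ y ^ᴿ n)
    × (∀ (y : ℝ) → ℕ→ℝ 2 ≤ᴿ y → ∣ eval (P 0) y ∣ᴿ ≤ᴿ y)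
theorem5p9 = P-estimate , P₀-estimate
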